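{- There is no planar graph $G$ satisfying any of the following: (i) $d(G) \geq 4$ and $e(v) = 0$ for all vertices $v$; (ii) $d(G) = 5$ and there is $c \in \{1,2,3\}$ such that $e(v) = c$ for all vertices $v$; (iii) $d(G) \leq 5$ and $e(v) = 6$ for all vertices $v$.
   Context: All graphs are finite, simple and have at least one vertex. $d(G)$ denotes the average degree of $G$, i.e. $2|E(G)|/|V(G)|$. For a vertex $v$, $e(v)$ denotes the number of edges of the subgraph of $G$ induced by the open neighbourhood $N(v)$ of $v$. -}

module Defs where

open import Data.Nat using (ℕ; zero; suc; _+_; _*_; _≤ᵇ_; _<ᵇ_; _≡ᵇ_; NonZero)
open import Data.Bool using (Bool; true; false; _∧_; _∨_; not; if_then_else_)
open import Data.Fin using (Fin; toℕ) renaming (zero to fz; suc to fs)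
open import Data.Fin.Properties using (_≟_)
open import Data.Product using (Σ; _×_; _,_; proj₁; proj₂)
open import Relation.Binary.PropositionalEquality using (_≡_)
open import Relation.Nullary.Decidable using (⌊_⌋)
open import Data.Integer using (+_)
open import Data.Rational using (ℚ; _/_)

record Graph (n : ℕ) : Set where
  field
    adj    : Fin n → Fin n → Bool
    sym    : ∀ u v → adj u v ≡ adj v u
    irrefl : ∀ v → adj v v ≡ false
open Graph public

count : ∀ {n} → (Fin n → Bool) → ℕ
count {zero}  f = 0
count {suc n} f = (if f fz then 1 else 0) + count (λ i → f (fs i))

sumF : ∀ {n} → (Fin n → ℕ) → ℕ
sumF {zero}  f = 0
sumF {suc n} f = f fz + sumF (λ i → f (fs i))

anyF : ∀ {n} → (Fin n → Bool) → Bool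
anyF {zero}  f = false
anyF {suc n} f = f fz ∨ anyF (λ i → f (fs i))

allF : ∀ {n} → (Fin n → Bool) → Bool
allF {zero}  f = true
allF {suc n} f = f fz ∧ allF (λ i → f (fs i))

allBelow : ℕ → (ℕ → Bool) → Bool
allBelow zero    p = true
allBelow (suc N) p = allBelow N p ∧ p N

iter : ∀ {A : Set} → (A → A) → ℕ → A → A
iter f zero    x = x
iter f (suc k) x = f (iter f k x)

eqF : ∀ {n} → Fin n → Fin n → Bool
eqF u v = ⌊ u ≟ v ⌋

module _ {n : ℕ} (G : Graph n) where

  edges : ℕ
  edges = sumF (λ u → count (λ v → adj G u v ∧ (toℕ u <ᵇ toℕ v)))

  degree : Fin n → ℕ
  degree v = count (λ u → adj G v u)

  e : Fin n → ℕ
  e v = sumF (λ u → count (λ w →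
          adj G v u ∧ adj G v w ∧ adj G u w ∧ (toℕ u <ᵇ toℕ w)))

  reach : ℕ → Fin n → Fin n → Bool
  reach zero    u w = eqF u w
  reach (suc k) u w = reach k u w ∨ anyF (λ x → reach k u x ∧ adj G x w)

  connected : Fin n → Fin n → Bool
  connected = reach n

  compRep : Fin n → Bool
  compRep v = allF (λ w → not (connected v w) ∨ (toℕ v ≤ᵇ toℕ w))

  isolated : Fin n → Bool
  isolated v = degree v ≡ᵇ 0

  #isolated : ℕ
  #isolated = count isolated

  #nontrivComps : ℕ
  #nontrivComps = count (λ v → compRep v ∧ not (isolated v))

-- Planarity via combinatorial embeddings (rotation systems).
-- rot u : Fin n → Fin n restricted to N(u) is the cyclic order of the
-- neighbours of u around u (values outside N(u) are irrelevant).

  record IsRotation (rot : Fin n → Fin n → Fin n) : Set where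
    field
      closed : ∀ u v → adj G u v ≡ true → adj G u (rot u v) ≡ true
      cyclic : ∀ u v w → adj G u v ≡ true → adj G u w ≡ true →
               Σ ℕ (λ k → iter (rot u) k v ≡ w)

  -- darts are ordered pairs (u , v) with u ~ v; face permutation
  facePerm : (Fin n → Fin n → Fin n) → Fin n × Fin n → Fin n × Fin n
  facePerm rot (u , v) = (v , rot v u)

  dartKey : Fin n × Fin n → ℕ
  dartKey (u , v) = toℕ u * n + toℕ v

  -- a dart is the minimal dart (by key) of its face orbit
  -- (orbits have length ≤ number of darts ≤ n * n)
  faceRep : (Fin n → Fin n → Fin n) → Fin n → Fin n → Bool
  faceRep rot u v = adj G u v ∧
    allBelow (n * n) (λ k →
      dartKey (u , v) ≤ᵇ dartKey (iter (facePerm rot) k (u , v)))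

  faces : (Fin n → Fin n → Fin n) → ℕ
  faces rot = sumF (λ u → count (λ v → faceRep rot u v))

  -- G is planar iff it has a rotation system of genus 0 on every
  -- component:  |V| - |E| + |F| = 2·(#components with an edge) + #isolated
  Planar : Set
  Planar = Σ (Fin n → Fin n → Fin n) (λ rot →
             IsRotation rot ×
             (n + faces rot ≡ edges + 2 * #nontrivComps + #isolated))

avgDeg : ∀ {n} → .{{_ : NonZero n}} → Graph n → ℚ
avgDeg {n} G = (+ (2 * edges G)) / n

{-# OPTIONS --safe #-}
module Submission where

-- Multiplying a permutation by a transposition changes its number of cycles by one. Adding the edges of a
-- map one at a time therefore never decreases the genus, so in a plane map an edge added between two
-- connected vertices always splits a face. It follows that if v p q is a triangle and p, q are not
-- consecutive around v, then the successors of p and of q around v are disconnected in G − {v, p, q}.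
--
-- For (i) and (ii), every dart lies in one face, and a face has length at least 4 unless it is a triangle
-- or an isolated edge; the triangular faces at v number at most 2 e(v), and at most max(2, e(v)).
-- Euler's formula then gives 6|E| < 12|V| + (number of corners of triangular faces).
--
-- For (iii), e(v) = 6 forces degree at least 5. In a smallest nonempty set of vertices whose outer boundary
-- is a clique, every vertex v has all edges of N(v) between consecutive neighbours: another such edge would
-- give a separating triangle, and one of its sides would cut out a smaller set. Hence 6 = e(v) ≤ deg v,
-- and the average degree exceeds 5.

-- Subgraphs live on the dart set of the whole graph. An edge that has not been added leaves its two
-- darts behind as half-edges in their corners, and the face permutation of the partial map passes
-- over them. So "this edge can be drawn inside one face" becomes "its two darts lie on one cycle",
-- and invariants of face tracing can refute it. The dart set consists of all ordered pairs of
-- vertices. A pair that is not adjacent is a fixed point of every permutation involved; with `M`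
-- such pairs, vertices, faces and components each grow by `M`, and the two sides of V + F = E + 2C
-- both grow by `2 * M`. The count for (ii) is exact: there 6|E| = 15|V|, while three corners at
-- each vertex give 12|V| + 3|V|. Hence the bound must be strict, and the strictness comes from the
-- components that contain an edge. The same component term pays for isolated edges, whose faces
-- have length two and would otherwise spoil the estimate by faces of length at least four.

open import Defs
open import Data.Bool using (Bool; true; false; _∧_; _∨_; not; if_then_else_; T)
import Data.Bool.Properties as Bool
open import Data.Empty using (⊥)
open import Data.Fin using (Fin; toℕ; fromℕ<; combine; remQuot; _↑ˡ_; _↑ʳ_) renaming (zero to fz; suc to fs)
import Data.Fin.Properties as Fin
open import Data.List using (List; []; _∷_; _++_; length; tabulate; map; filter)
import Data.List.Properties as List
open import Data.List.Membership.Propositional using (_∈_; _∉_)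
open import Data.List.Membership.Propositional.Properties
  using (∈-tabulate⁺; ∈-tabulate⁻; ∈-filter⁺; ∈-filter⁻; ∈-map⁺; ∈-map⁻; ∈-++⁺ˡ; ∈-++⁺ʳ; ∈-++⁻)
open import Data.List.Relation.Unary.All as All using ()
open import Data.List.Relation.Unary.AllPairs using (_∷_)
open import Data.List.Relation.Unary.Any using (here; there)
open import Data.List.Relation.Unary.Unique.Propositional using (Unique)
import Data.List.Relation.Unary.Unique.Propositional.Properties as Unique
open import Data.Nat using (ℕ; zero; suc; _+_; _*_; _≤_; _<_; z≤n; s≤s; _≤ᵇ_; _<ᵇ_; _≡ᵇ_)
import Data.Nat as ℕ using (_/_; _%_)
open import Data.Nat.DivMod using (m≡m%n+[m/n]*n; m%n<n)
open import Data.Nat.Properties hiding (_≟_)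
open import Data.Nat.Tactic.RingSolver using (solve-∀)
open import Data.Product using (Σ; ∃; _×_; _,_; proj₁; proj₂; swap; uncurry)
open import Data.Product.Properties using (≡-dec; ,-injective)
open import Data.Sum using (_⊎_; inj₁; inj₂)
open import Data.Unit using (tt)
open import Function using (_∘_; case_of_; id)
open import Function.Definitions using (Injective)
open import Relation.Binary using (IsEquivalence; DecidableEquality; tri<; tri≈; tri>)
open import Relation.Binary.PropositionalEquality hiding (sym)
import Relation.Binary.PropositionalEquality as ≡
open import Relation.Nullary using (¬_; Dec; yes; no; does; contradiction)
open import Relation.Nullary.Decidable using (dec-true; dec-false; _×-dec_; ¬?)

open import Algebra.Properties.CommutativeSemigroup +-commutativeSemigroup
  using () renaming (interchange to +-interchange)

-- Finite sums

⟦_⟧ : Bool → ℕ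
⟦ b ⟧ = if b then 1 else 0

⟦⟧-mono : ∀ {a b} → (a ≡ true → b ≡ true) → ⟦ a ⟧ ≤ ⟦ b ⟧
⟦⟧-mono {false}         h = z≤n
⟦⟧-mono {true}  {true}  h = ≤-refl
⟦⟧-mono {true}  {false} h = case h refl of λ ()

⟦⟧-true : ∀ {b} → 1 ≤ ⟦ b ⟧ → b ≡ true
⟦⟧-true {true} _ = refl

does⇒ : ∀ {ℓ} {P : Set ℓ} (d : Dec P) → does d ≡ true → P
does⇒ (yes p) _ = p

∧-true : ∀ {a b} → a ∧ b ≡ true → a ≡ true × b ≡ true
∧-true {true} {true} _ = refl , refl

true∧ : ∀ {a b} → a ≡ true → b ≡ true → a ∧ b ≡ true
true∧ refl refl = refl

≢true⇒≡false : ∀ {b} → ¬ b ≡ true → b ≡ false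
≢true⇒≡false {true}  h = contradiction refl h
≢true⇒≡false {false} h = refl

sumF-cong : ∀ {n} {f g : Fin n → ℕ} → (∀ i → f i ≡ g i) → sumF f ≡ sumF g
sumF-cong {zero}  h = refl
sumF-cong {suc n} h = cong₂ _+_ (h fz) (sumF-cong (h ∘ fs))

sumF-mono : ∀ {n} {f g : Fin n → ℕ} → (∀ i → f i ≤ g i) → sumF f ≤ sumF g
sumF-mono {zero}  h = z≤n
sumF-mono {suc n} h = +-mono-≤ (h fz) (sumF-mono (h ∘ fs))

sumF-+ : ∀ {n} (f g : Fin n → ℕ) → sumF (λ i → f i + g i) ≡ sumF f + sumF g
sumF-+ {zero}  f g = refl
sumF-+ {suc n} f g rewrite sumF-+ (f ∘ fs) (g ∘ fs) = +-interchange (f fz) (g fz) _ _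

sumF-const : ∀ n c → sumF {n} (λ _ → c) ≡ n * c
sumF-const zero    c = refl
sumF-const (suc n) c = cong (c +_) (sumF-const n c)

sumF-0 : ∀ n → sumF {n} (λ _ → 0) ≡ 0
sumF-0 n = trans (sumF-const n 0) (*-zeroʳ n)

sumF-*ˡ : ∀ {n} c (f : Fin n → ℕ) → sumF (λ i → c * f i) ≡ c * sumF f
sumF-*ˡ {zero}  c f = ≡.sym (*-zeroʳ c)
sumF-*ˡ {suc n} c f rewrite sumF-*ˡ c (f ∘ fs) = ≡.sym (*-distribˡ-+ c (f fz) _)

sumF-swap : ∀ {m n} (f : Fin m → Fin n → ℕ) →
            sumF (λ i → sumF (λ j → f i j)) ≡ sumF (λ j → sumF (λ i → f i j))
sumF-swap {zero}  {n} f = ≡.sym (sumF-0 n)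
sumF-swap {suc m} {n} f = begin
  sumF (f fz) + sumF (λ i → sumF (f (fs i)))            ≡⟨ cong (sumF (f fz) +_) (sumF-swap (f ∘ fs)) ⟩
  sumF (f fz) + sumF (λ j → sumF (λ i → f (fs i) j))    ≡⟨ sumF-+ (f fz) _ ⟨
  sumF (λ j → f fz j + sumF (λ i → f (fs i) j))         ∎
  where open ≡-Reasoning

sumF-δ : ∀ {n} (i : Fin n) (f : Fin n → ℕ) →
         sumF (λ j → if does (i Fin.≟ j) then f j else 0) ≡ f i
sumF-δ {suc n} fz f = trans (cong (f fz +_) (sumF-0 n)) (+-identityʳ (f fz))
sumF-δ {suc n} (fs i) f = sumF-δ i (f ∘ fs)

sumF-combine : ∀ m n (f : Fin (m * n) → ℕ) →
               sumF f ≡ sumF (λ i → sumF (λ j → f (combine {m} {n} i j)))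
sumF-combine zero    n f = refl
sumF-combine (suc m) n f = trans (sumF-++ n (m * n) f) (cong (sumF (λ j → f (j ↑ˡ m * n)) +_)
      (sumF-combine m n (λ k → f (n ↑ʳ k))))
  where
  sumF-++ : ∀ a b (g : Fin (a + b) → ℕ) →
            sumF g ≡ sumF (λ i → g (i ↑ˡ b)) + sumF (λ j → g (a ↑ʳ j))
  sumF-++ zero    b g = refl
  sumF-++ (suc a) b g = trans (cong (g fz +_) (sumF-++ a b (g ∘ fs))) (≡.sym (+-assoc (g fz) _ _))

count≡sumF : ∀ {n} (p : Fin n → Bool) → count p ≡ sumF (λ i → ⟦ p i ⟧)
count≡sumF {zero}  p = refl
count≡sumF {suc n} p = cong (⟦ p fz ⟧ +_) (count≡sumF (p ∘ fs))

∃⇒1≤sumF : ∀ {n} (f : Fin n → ℕ) i → 1 ≤ f i → 1 ≤ sumF f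
∃⇒1≤sumF f fz     h = ≤-trans h (m≤m+n (f fz) _)
∃⇒1≤sumF f (fs i) h = ≤-trans (∃⇒1≤sumF (f ∘ fs) i h) (m≤n+m _ (f fz))

1≤sumF⇒∃ : ∀ {n} (f : Fin n → ℕ) → 1 ≤ sumF f → ∃ λ i → 1 ≤ f i
1≤sumF⇒∃ {suc n} f h with f fz in eq
... | suc k = fz , subst (1 ≤_) (≡.sym eq) (s≤s z≤n)
... | zero with 1≤sumF⇒∃ (f ∘ fs) h
...   | i , h′ = fs i , h′

sumF-≤1 : ∀ {n} (p : Fin n → Bool) → (∀ i j → p i ≡ true → p j ≡ true → i ≡ j) →
          sumF (λ i → ⟦ p i ⟧) ≤ 1
sumF-≤1 {zero}  p h = z≤n
sumF-≤1 {suc n} p h with p fz in eq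
... | false = sumF-≤1 (p ∘ fs) (λ i j a b → Fin.suc-injective (h (fs i) (fs j) a b))
... | true  = ≤-reflexive (cong suc (trans (sumF-cong vanish) (sumF-0 n)))
  where
  vanish : ∀ i → ⟦ p (fs i) ⟧ ≡ 0
  vanish i with p (fs i) in eq′
  ... | false = refl
  ... | true  = case h fz (fs i) eq eq′ of λ ()

-- Double counting: the unit of each `i` is placed in column `g i`, and by injectivity on `p` a
-- column receives at most one unit.
sumF-injection : ∀ {m n} (p : Fin m → Bool) (q : Fin n → Bool) (g : Fin m → Fin n) →
                 (∀ i → p i ≡ true → q (g i) ≡ true) →
                 (∀ i j → p i ≡ true → p j ≡ true → g i ≡ g j → i ≡ j) →
                 sumF (λ i → ⟦ p i ⟧) ≤ sumF (λ j → ⟦ q j ⟧)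
sumF-injection {m} {n} p q g maps inj = begin
  sumF (λ i → ⟦ p i ⟧)
    ≡⟨ sumF-cong (λ i → ≡.sym (sumF-δ (g i) (λ _ → ⟦ p i ⟧))) ⟩
  sumF (λ i → sumF (λ j → if does (g i Fin.≟ j) then ⟦ p i ⟧ else 0))
    ≡⟨ sumF-swap (λ i j → if does (g i Fin.≟ j) then ⟦ p i ⟧ else 0) ⟩
  sumF (λ j → sumF (λ i → if does (g i Fin.≟ j) then ⟦ p i ⟧ else 0))
    ≤⟨ sumF-mono fibre ⟩
  sumF (λ j → ⟦ q j ⟧) ∎
  where
  open ≤-Reasoning
  fibre : ∀ j → sumF (λ i → if does (g i Fin.≟ j) then ⟦ p i ⟧ else 0) ≤ ⟦ q j ⟧
  fibre j with q j in eq
  ... | true = ≤-trans (≤-reflexive (sumF-cong merge-if)) (sumF-≤1 _ unique)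
    where
    merge-if : ∀ i → (if does (g i Fin.≟ j) then ⟦ p i ⟧ else 0) ≡ ⟦ does (g i Fin.≟ j) ∧ p i ⟧
    merge-if i with does (g i Fin.≟ j)
    ... | true  = refl
    ... | false = refl
    unique : ∀ i k → does (g i Fin.≟ j) ∧ p i ≡ true → does (g k Fin.≟ j) ∧ p k ≡ true → i ≡ k
    unique i k a b =
      let a₁ , a₂ = ∧-true a ; b₁ , b₂ = ∧-true b
      in inj i k a₂ b₂ (trans (does⇒ (g i Fin.≟ j) a₁) (≡.sym (does⇒ (g k Fin.≟ j) b₁)))
  ... | false = ≤-reflexive (trans (sumF-cong vanish) (sumF-0 m))
    where
    vanish : ∀ i → (if does (g i Fin.≟ j) then ⟦ p i ⟧ else 0) ≡ 0
    vanish i with g i Fin.≟ j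
    ... | no _ = refl
    ... | yes gi≡j with p i in eq′
    ...   | false = refl
    ...   | true  = case trans (≡.sym eq) (trans (cong q (≡.sym gi≡j)) (maps i eq′)) of λ ()

-- Iterates, partitions and the genus of a permutation with transpositions

module _ {A : Set} (f : A → A) where

  iter-+ : ∀ j k x → iter f (j + k) x ≡ iter f j (iter f k x)
  iter-+ zero    k x = refl
  iter-+ (suc j) k x = cong f (iter-+ j k x)

  iter-suc : ∀ k x → iter f (suc k) x ≡ iter f k (f x)
  iter-suc zero    x = refl
  iter-suc (suc k) x = cong f (iter-suc k x)

  iter-* : ∀ m {x} → iter f m x ≡ x → ∀ k → iter f (k * m) x ≡ x
  iter-* m eq zero = refl
  iter-* m {x} eq (suc k) =
    trans (iter-+ m (k * m) x) (trans (cong (iter f m) (iter-* m eq k)) eq)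

  iter-injective : Injective _≡_ _≡_ f → ∀ k → Injective _≡_ _≡_ (iter f k)
  iter-injective inj zero    eq = eq
  iter-injective inj (suc k) eq = iter-injective inj k (inj eq)

  -- Meant for a rotation, which is controlled only on the neighbours of a vertex. Both points
  -- return after the common multiple `suc j * suc k` of their periods, and after the first step the
  -- two walks coincide.
  periodic-injective : ∀ {x y} j k → iter f (suc j) x ≡ x → iter f (suc k) y ≡ y → f x ≡ f y → x ≡ y
  periodic-injective {x} {y} j k px py eq = begin
    x                                ≡⟨ iter-* (suc j) px (suc k) ⟨
    iter f (suc k * suc j) x         ≡⟨ iter-suc (j + k * suc j) x ⟩
    iter f (j + k * suc j) (f x)     ≡⟨ cong₂ (λ m z → iter f m z) (suc-injective (*-comm (suc k) (suc j))) eq ⟩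
    iter f (k + j * suc k) (f y)     ≡⟨ iter-suc (k + j * suc k) y ⟨
    iter f (suc j * suc k) y         ≡⟨ iter-* (suc k) py (suc j) ⟩
    y                                ∎
    where open ≡-Reasoning

record Finite (A : Set) : Set where
  field
    size       : ℕ
    enum       : Fin size → A
    index      : A → Fin size
    enum-index : ∀ a → enum (index a) ≡ a
    index-enum : ∀ i → index (enum i) ≡ i
    _≟_        : DecidableEquality A

  index-injective : ∀ {a b} → index a ≡ index b → a ≡ b
  index-injective eq = trans (≡.sym (enum-index _)) (trans (cong enum eq) (enum-index _))

  enum-injective : ∀ {i j} → enum i ≡ enum j → i ≡ j
  enum-injective eq = trans (≡.sym (index-enum _)) (trans (cong index eq) (index-enum _))

  ∑ : (A → ℕ) → ℕ
  ∑ f = sumF (f ∘ enum)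

  # : (A → Bool) → ℕ
  # p = ∑ (⟦_⟧ ∘ p)

  #-injection : (p q : A → Bool) (g : A → A) → (∀ a → p a ≡ true → q (g a) ≡ true) →
                (∀ a b → p a ≡ true → p b ≡ true → g a ≡ g b → a ≡ b) → # p ≤ # q
  #-injection p q g maps inj = sumF-injection (p ∘ enum) (q ∘ enum) (index ∘ g ∘ enum)
    (λ i pi → trans (cong q (enum-index _)) (maps (enum i) pi))
    (λ i j pi pj eq → enum-injective (inj _ _ pi pj (index-injective eq)))

  #-singleton : ∀ a → # (λ b → does (a ≟ b)) ≡ 1
  #-singleton a = trans (sumF-cong agree) (sumF-δ (index a) (λ _ → 1))
    where
    agree : ∀ i → ⟦ does (a ≟ enum i) ⟧ ≡ (if does (index a Fin.≟ i) then 1 else 0)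
    agree i with a ≟ enum i | index a Fin.≟ i
    ... | yes _ | yes _ = refl
    ... | no _  | no _  = refl
    ... | yes p | no ¬q = contradiction (trans (cong index p) (index-enum i)) ¬q
    ... | no ¬p | yes q = contradiction (trans (≡.sym (enum-index a)) (cong enum q)) ¬p

  module _ {f : A → A} (inj : Injective _≡_ _≡_ f) where

    periodic : ∀ a → ∃ λ m → m < size × iter f (suc m) a ≡ a
    periodic a with Fin.pigeonhole (n<1+n size) (λ i → index (iter f (toℕ i) a))
    ... | i , j , i<j , eq with m≤n⇒∃[o]m+o≡n i<j
    ...   | m , i+m≡j = m , ≤-trans (s≤s (m≤n+m m (toℕ i)))
                              (≤-trans (≤-reflexive i+m≡j) (≤-pred (Fin.toℕ<n j)))
                          , ≡.sym (iter-injective f inj (toℕ i) (begin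
      iter f (toℕ i) a                    ≡⟨ index-injective eq ⟩
      iter f (toℕ j) a                    ≡⟨ cong (λ k → iter f k a) (trans (≡.sym i+m≡j) (≡.sym (+-suc (toℕ i) m))) ⟩
      iter f (toℕ i + suc m) a            ≡⟨ iter-+ f (toℕ i) (suc m) a ⟩
      iter f (toℕ i) (iter f (suc m) a)   ∎))
      where open ≡-Reasoning

    -- `faceRep` inspects only the first `n * n` iterates; reduction modulo the period shows that
    -- these already exhaust the orbit.
    iter-bounded : ∀ a k → ∃ λ j → j < size × iter f j a ≡ iter f k a
    iter-bounded a k with periodic a
    ... | m , m<size , eq = k ℕ.% suc m , ≤-trans (m%n<n k (suc m)) m<size , (begin
      iter f (k ℕ.% suc m) a
            ≡⟨ cong (iter f (k ℕ.% suc m)) (iter-* f (suc m) eq (k ℕ./ suc m)) ⟨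
      iter f (k ℕ.% suc m) (iter f (k ℕ./ suc m * suc m) a)      ≡⟨ iter-+ f (k ℕ.% suc m) _ a ⟨
      iter f (k ℕ.% suc m + k ℕ./ suc m * suc m) a
            ≡⟨ cong (λ j → iter f j a) (m≡m%n+[m/n]*n k (suc m)) ⟨
      iter f k a                                             ∎)
      where open ≡-Reasoning

    Orbit : A → A → Set
    Orbit a b = ∃ λ k → iter f k a ≡ b

    orbit-sym : ∀ {a b} → Orbit a b → Orbit b a
    orbit-sym {a} (zero  , refl) = 0 , refl
    orbit-sym {a} (suc k , refl) with periodic a
    -- The period is `suc m`, so `suc k * m` further steps make `suc k * suc m` in all, a multiple
    -- of the period.
    ... | m , _ , eq = suc k * m , (begin
      iter f (suc k * m) (iter f (suc k) a) ≡⟨ iter-+ f (suc k * m) (suc k) a ⟨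
      iter f (suc k * m + suc k) a          ≡⟨ cong (λ j → iter f j a)
            (trans (+-comm (suc k * m) (suc k)) (≡.sym (*-suc (suc k) m))) ⟩
      iter f (suc k * suc m) a              ≡⟨ iter-* f (suc m) eq (suc k) ⟩
      a                                     ∎)
      where open ≡-Reasoning

    orbit-isEquivalence : IsEquivalence Orbit
    orbit-isEquivalence = record
      { refl  = 0 , refl
      ; sym   = orbit-sym
      ; trans = λ { {a} (j , refl) (k , refl) → k + j , iter-+ f k j a }
      }

-- An idempotent choice of representatives makes the equivalence decidable and turns the number of
-- classes into the number of fixed points of `rep`.
record Partition (A : Set) : Set where
  field
    rep  : A → A
    idem : ∀ a → rep (rep a) ≡ rep a

  infix 4 _~_
  _~_ : A → A → Set
  a ~ b = rep a ≡ rep b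
open Partition public using () renaming (_~_ to ⟨_⟩_~_)

module Partitions {A : Set} (fin : Finite A) where
  open Finite fin
  open Partition

  merge : Partition A → A → A → Partition A
  merge P a b = record { rep = rep′ ; idem = idem′ }
    where
    rep′ : A → A
    rep′ c = if does (rep P c ≟ rep P a) then rep P b else rep P c
    fixes : ∀ c → rep P c ≡ c → c ≡ rep P b ⊎ ¬ c ≡ rep P a → rep′ c ≡ c
    fixes c fc h with rep P c ≟ rep P a | h
    ... | no _  | _       = fc
    ... | yes _ | inj₁ eq = ≡.sym eq
    ... | yes p | inj₂ ne = contradiction (trans (≡.sym fc) p) ne
    idem′ : ∀ c → rep′ (rep′ c) ≡ rep′ c
    idem′ c with rep P c ≟ rep P a
    ... | yes _ = fixes (rep P b) (idem P b) (inj₁ refl)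
    ... | no ne = fixes (rep P c) (idem P c) (inj₂ ne)

  merge-elim : (R : A → A → Set) → IsEquivalence R → ∀ P {a b} →
               (∀ {c d} → ⟨ P ⟩ c ~ d → R c d) → R a b → ∀ {c d} → ⟨ merge P a b ⟩ c ~ d → R c d
  merge-elim R R-eq P {a} {b} P⊆R Rab {c} {d} eq with rep P c ≟ rep P a | rep P d ≟ rep P a
  ... | yes p | yes q = P⊆R (trans p (≡.sym q))
  ... | no _  | no _  = P⊆R eq
  ... | yes p | no _  = IsEquivalence.trans R-eq (P⊆R p) (IsEquivalence.trans R-eq Rab (P⊆R eq))
  ... | no _  | yes q = IsEquivalence.trans R-eq (P⊆R eq)
                          (IsEquivalence.sym R-eq (IsEquivalence.trans R-eq (P⊆R q) Rab))

  merge-⊇ : ∀ P {a b c d} → ⟨ P ⟩ c ~ d → ⟨ merge P a b ⟩ c ~ d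
  merge-⊇ P eq rewrite eq = refl

  merge-joins : ∀ P a b → ⟨ merge P a b ⟩ a ~ b
  merge-joins P a b with rep P a ≟ rep P a | rep P b ≟ rep P a
  ... | no ne | _     = contradiction refl ne
  ... | yes _ | yes _ = refl
  ... | yes _ | no _  = refl

  ~-isEquivalence : (P : Partition A) → IsEquivalence (⟨ P ⟩_~_)
  ~-isEquivalence P = record { refl = refl ; sym = ≡.sym ; trans = trans }

  isRep : Partition A → A → Bool
  isRep P a = does (rep P a ≟ a)

  classes : Partition A → ℕ
  classes P = # (isRep P)

  #≤classes : ∀ P (p : A → Bool) → (∀ a b → p a ≡ true → p b ≡ true → ⟨ P ⟩ a ~ b → a ≡ b) →
              # p ≤ classes P
  #≤classes P p inj = #-injection p (isRep P) (rep P) (λ a _ → dec-true (_ ≟ _) (idem P a)) inj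

  classes≤# : ∀ P (p : A → Bool) → (∀ a → ∃ λ b → p b ≡ true × ⟨ P ⟩ a ~ b) → classes P ≤ # p
  classes≤# P p cover = #-injection (isRep P) p (λ a → proj₁ (cover a)) (λ a _ → proj₁ (proj₂ (cover a)))
    λ a b fa fb eq → begin
      a                       ≡⟨ does⇒ (_ ≟ _) fa ⟨
      rep P a                 ≡⟨ proj₂ (proj₂ (cover a)) ⟩
      rep P (proj₁ (cover a)) ≡⟨ cong (rep P) eq ⟩
      rep P (proj₁ (cover b)) ≡⟨ proj₂ (proj₂ (cover b)) ⟨
      rep P b                 ≡⟨ does⇒ (_ ≟ _) fb ⟩
      b                       ∎
    where open ≡-Reasoning

  classes-antitone : ∀ P Q → (∀ {a b} → ⟨ P ⟩ a ~ b → ⟨ Q ⟩ a ~ b) → classes Q ≤ classes P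
  classes-antitone P Q P⊆Q = #≤classes P (isRep Q) λ a b fa fb eq →
    trans (≡.sym (does⇒ (_ ≟ _) fa)) (trans (P⊆Q eq) (does⇒ (_ ≟ _) fb))

  -- Among the old representatives only `rep P a` can cease to be one.
  classes≤1+merge : ∀ P a b → classes P ≤ suc (classes (merge P a b))
  classes≤1+merge P a b = begin
    classes P ≤⟨ sumF-mono (λ i → pointwise (enum i)) ⟩
    ∑ (λ c → ⟦ does (rep P a ≟ c) ⟧ + ⟦ does (rep (merge P a b) c ≟ c) ⟧)
          ≡⟨ sumF-+ (λ i → ⟦ does (rep P a ≟ enum i) ⟧) _ ⟩
    # (λ c → does (rep P a ≟ c)) + classes (merge P a b) ≡⟨ cong (_+ classes (merge P a b)) (#-singleton (rep P a)) ⟩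
    suc (classes (merge P a b)) ∎
    where
    open ≤-Reasoning
    pointwise : ∀ c → ⟦ does (rep P c ≟ c) ⟧ ≤ ⟦ does (rep P a ≟ c) ⟧ + ⟦ does (rep (merge P a b) c ≟ c) ⟧
    pointwise c with rep P c ≟ c | rep P a ≟ c
    ... | no _   | _     = z≤n
    ... | yes _  | yes _ = s≤s z≤n
    ... | yes fc | no ne with rep P c ≟ rep P a
    ...   | yes p = contradiction (trans (≡.sym p) fc) ne
    ...   | no _  = ≤-reflexive (cong ⟦_⟧ (≡.sym (dec-true (rep P c ≟ c) fc)))

  -- Now `rep P a` does cease to be fixed, being sent to the different point `rep P b`, and no new
  -- fixed point arises.
  1+merge≤classes : ∀ P {a b} → ¬ ⟨ P ⟩ a ~ b → suc (classes (merge P a b)) ≤ classes P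
  1+merge≤classes P {a} {b} a≁b = begin
    suc (classes (merge P a b)) ≡⟨ cong (_+ classes (merge P a b)) (#-singleton (rep P a)) ⟨
    # (λ c → does (rep P a ≟ c)) + classes (merge P a b) ≡⟨ sumF-+ (λ i → ⟦ does (rep P a ≟ enum i) ⟧) _ ⟨
    ∑ (λ c → ⟦ does (rep P a ≟ c) ⟧ + ⟦ does (rep (merge P a b) c ≟ c) ⟧) ≤⟨ sumF-mono (λ i → pointwise (enum i)) ⟩
    classes P ∎
    where
    open ≤-Reasoning
    pointwise : ∀ c → ⟦ does (rep P a ≟ c) ⟧ + ⟦ does (rep (merge P a b) c ≟ c) ⟧ ≤ ⟦ does (rep P c ≟ c) ⟧
    pointwise c with rep P a ≟ c | rep P c ≟ rep P a
    ... | yes refl | no ne = contradiction (idem P a) ne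
    ... | yes refl | yes p with rep P b ≟ rep P a
    ...   | yes q = contradiction (≡.sym q) a≁b
    ...   | no _  = ≤-reflexive (cong ⟦_⟧ (≡.sym (dec-true (_ ≟ _) p)))
    pointwise c | no ne | no _  = ≤-refl
    pointwise c | no ne | yes p with rep P b ≟ c
    ...   | yes refl = contradiction (trans (≡.sym p) (idem P b)) a≁b
    ...   | no _     = z≤n

  discrete : Partition A
  discrete = record { rep = id ; idem = λ _ → refl }

  generated : List (A × A) → Partition A
  generated []            = discrete
  generated ((a , b) ∷ l) = merge (generated l) a b

  generated-∋ : ∀ {a b l} → (a , b) ∈ l → ⟨ generated l ⟩ a ~ b
  generated-∋ {a} {b} {_ ∷ l} (here refl) = merge-joins (generated l) a b
  generated-∋ {l = _ ∷ l}     (there m)   = merge-⊇ (generated l) (generated-∋ m)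

  generated-elim : (R : A → A → Set) → IsEquivalence R → ∀ l → (∀ {a b} → (a , b) ∈ l → R a b) →
                   ∀ {c d} → ⟨ generated l ⟩ c ~ d → R c d
  generated-elim R R-eq []      h refl = IsEquivalence.refl R-eq
  generated-elim R R-eq (_ ∷ l) h      =
    merge-elim R R-eq (generated l) (generated-elim R R-eq l (h ∘ there)) (h (here refl))

  -- As a generated equivalence it can be mapped into any equivalence that contains the steps of
  -- `f`; for injective `f` its classes are the forward orbits, by `cycles⇒orbit`.
  cycles : (A → A) → Partition A
  cycles f = generated (tabulate (λ i → enum i , f (enum i)))

  cycles-step : ∀ f a → ⟨ cycles f ⟩ a ~ f a
  cycles-step f a = subst (λ z → ⟨ cycles f ⟩ z ~ f z) (enum-index a)
                      (generated-∋ (∈-tabulate⁺ (index a)))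

  cycles-elim : ∀ f (R : A → A → Set) → IsEquivalence R → (∀ a → R a (f a)) →
                ∀ {c d} → ⟨ cycles f ⟩ c ~ d → R c d
  cycles-elim f R R-eq h = generated-elim R R-eq (tabulate (λ i → enum i , f (enum i))) λ m
        → case ∈-tabulate⁻ m of λ { (i , refl) → h (enum i) }

  cycles-iter : ∀ f k a → ⟨ cycles f ⟩ a ~ iter f k a
  cycles-iter f zero    a = refl
  cycles-iter f (suc k) a = trans (cycles-iter f k a) (cycles-step f (iter f k a))

  cycles⇒orbit : ∀ {f} (inj : Injective _≡_ _≡_ f) {a b} → ⟨ cycles f ⟩ a ~ b → Orbit inj a b
  cycles⇒orbit {f} inj = cycles-elim f (Orbit inj) (orbit-isEquivalence inj) (λ a → 1 , refl)

  transpose : A × A → A → A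
  transpose (a , b) c = if does (c ≟ a) then b else if does (c ≟ b) then a else c

  transpose-left : ∀ a b → transpose (a , b) a ≡ b
  transpose-left a b rewrite dec-true (a ≟ a) refl = refl

  transpose-right : ∀ a b → transpose (a , b) b ≡ a
  transpose-right a b with b ≟ a
  ... | yes refl = refl
  ... | no _ rewrite dec-true (b ≟ b) refl = refl

  transpose-other : ∀ {a b c} → ¬ c ≡ a → ¬ c ≡ b → transpose (a , b) c ≡ c
  transpose-other {a} {b} {c} c≢a c≢b rewrite dec-false (c ≟ a) c≢a | dec-false (c ≟ b) c≢b = refl

  transpose-involutive : ∀ t c → transpose t (transpose t c) ≡ c
  transpose-involutive t@(a , b) c with c ≟ a
  ... | yes refl = transpose-right a b
  ... | no c≢a with c ≟ b
  ...   | yes refl = transpose-left a b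
  ...   | no c≢b   = transpose-other c≢a c≢b

  module _ {f : A → A} (inj : Injective _≡_ _≡_ f) {a b : A} where

    private
      g : A → A
      g = f ∘ transpose (a , b)

    transpose-injective : Injective _≡_ _≡_ g
    transpose-injective eq = trans (≡.sym (transpose-involutive (a , b) _))
      (trans (cong (transpose (a , b)) (inj eq)) (transpose-involutive (a , b) _))

    -- Following f from f b = g a, one returns to b without meeting a, so that g takes the same steps.
    transpose-joins : ¬ ⟨ cycles f ⟩ a ~ b → ⟨ cycles g ⟩ a ~ b
    transpose-joins a≁b with periodic inj b
    ... | m , _ , eq = follow m (trans (≡.sym (iter-suc f m b)) eq)
                         (trans (cong rep-g (≡.sym ga≡fb)) (≡.sym (cycles-step g a)))
                         (cycles-step f b)
      where
      rep-g = rep (cycles g)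
      ga≡fb : g a ≡ f b
      ga≡fb = cong f (transpose-left a b)
      follow : ∀ k {c} → iter f k c ≡ b → ⟨ cycles g ⟩ c ~ a → ⟨ cycles f ⟩ b ~ c → ⟨ cycles g ⟩ a ~ b
      follow zero refl c~a _ = ≡.sym c~a
      follow (suc k) {c} eq c~a b~c with c ≟ b
      ... | yes refl = ≡.sym c~a
      ... | no c≢b = follow k (trans (≡.sym (iter-suc f k c)) eq)
              (trans (cong rep-g (≡.sym gc≡fc)) (trans (≡.sym (cycles-step g c)) c~a))
              (trans b~c (cycles-step f c))
        where
        c≢a : ¬ c ≡ a
        c≢a refl = a≁b (≡.sym b~c)
        gc≡fc : g c ≡ f c
        gc≡fc = cong f (transpose-other c≢a c≢b)

    -- The two maps differ only in that `f a` is `g b` and `f b` is `g a`; since `g` joins `a` to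
    -- `b`, these two steps survive as well.
    cycles⊆cycles-transpose : ¬ ⟨ cycles f ⟩ a ~ b → ∀ {c d} → ⟨ cycles f ⟩ c ~ d → ⟨ cycles g ⟩ c ~ d
    cycles⊆cycles-transpose a≁b = cycles-elim f _ (~-isEquivalence (cycles g)) step
      where
      step : ∀ c → ⟨ cycles g ⟩ c ~ f c
      step c with c ≟ a | c ≟ b
      ... | yes refl | _ = trans (transpose-joins a≁b)
              (trans (cycles-step g b) (cong (rep (cycles g)) (cong f (transpose-right a b))))
      ... | no _ | yes refl = trans (≡.sym (transpose-joins a≁b))
              (trans (cycles-step g a) (cong (rep (cycles g)) (cong f (transpose-left a b))))
      ... | no c≢a | no c≢b = trans (cycles-step g c)
              (cong (rep (cycles g)) (cong f (transpose-other c≢a c≢b)))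

    cycles-joined : ¬ ⟨ cycles f ⟩ a ~ b → suc (classes (cycles g)) ≤ classes (cycles f)
    cycles-joined a≁b = ≤-trans
      (s≤s (classes-antitone (merge (cycles f) a b) (cycles g)
        (merge-elim _ (~-isEquivalence (cycles g)) (cycles f) (cycles⊆cycles-transpose a≁b)
          (transpose-joins a≁b))))
      (1+merge≤classes (cycles f) a≁b)

    -- Each step of `f` is a step of `g`, possibly after a move between `a` and `b`. Adding that one
    -- pair to the cycles of `g` thus gives something at least as coarse as the cycles of `f`, and
    -- one merge loses at most one class.
    cycles-transpose : classes (cycles g) ≤ suc (classes (cycles f))
    cycles-transpose = ≤-trans (classes≤1+merge (cycles g) a b)
      (s≤s (classes-antitone (cycles f) M (cycles-elim f _ (~-isEquivalence M) step)))
      where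
      M = merge (cycles g) a b
      up : ∀ {c d} → ⟨ cycles g ⟩ c ~ d → ⟨ M ⟩ c ~ d
      up = merge-⊇ (cycles g) {a} {b}
      step : ∀ c → ⟨ M ⟩ c ~ f c
      step c with c ≟ a | c ≟ b
      ... | yes refl | _ = trans (merge-joins (cycles g) a b)
              (up (trans (cycles-step g b) (cong (rep (cycles g)) (cong f (transpose-right a b)))))
      ... | no _ | yes refl = trans (≡.sym (merge-joins (cycles g) a b))
              (up (trans (cycles-step g a) (cong (rep (cycles g)) (cong f (transpose-left a b)))))
      ... | no c≢a | no c≢b = up (trans (cycles-step g c)
              (cong (rep (cycles g)) (cong f (transpose-other c≢a c≢b))))

  -- The genus inequality for maps built edge by edge

  module Euler {σ : A → A} (σ-inj : Injective _≡_ _≡_ σ) where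

    -- For disjoint edges this is `σ` after the edge involution: cross the edge, then turn. A dart
    -- whose edge is not listed is moved by `σ` alone, as a half-edge lying in its corner of the
    -- face.
    face : List (A × A) → A → A
    face []      = σ
    face (t ∷ l) = face l ∘ transpose t

    component : List (A × A) → Partition A
    component []            = cycles σ
    component ((a , b) ∷ l) = merge (component l) a b

    face-injective : ∀ l → Injective _≡_ _≡_ (face l)
    face-injective []      = σ-inj
    face-injective (t ∷ l) = transpose-injective (face-injective l)

    component-σ : ∀ l a → ⟨ component l ⟩ a ~ σ a
    component-σ []            a = cycles-step σ a
    component-σ ((b , c) ∷ l) a = merge-⊇ (component l) (component-σ l a)

    component-∋ : ∀ {a b l} → (a , b) ∈ l → ⟨ component l ⟩ a ~ b
    component-∋ {a} {b} {_ ∷ l} (here refl) = merge-joins (component l) a b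
    component-∋ {l = _ ∷ l}     (there m)   = merge-⊇ (component l) (component-∋ m)

    component-elim : (R : A → A → Set) → IsEquivalence R → (∀ a → R a (σ a)) → ∀ l →
                     (∀ {a b} → (a , b) ∈ l → R a b) → ∀ {c d} → ⟨ component l ⟩ c ~ d → R c d
    component-elim R R-eq h []      h′ = cycles-elim σ R R-eq h
    component-elim R R-eq h (_ ∷ l) h′ =
      merge-elim R R-eq (component l) (component-elim R R-eq h l (h′ ∘ there)) (h′ (here refl))

    face⊆component : ∀ l {c d} → ⟨ cycles (face l) ⟩ c ~ d → ⟨ component l ⟩ c ~ d
    face⊆component l = cycles-elim (face l) _ (~-isEquivalence (component l)) (step l)
      where
      step : ∀ l c → ⟨ component l ⟩ c ~ face l c
      step []            c = cycles-step σ c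
      step ((a , b) ∷ l) c with c ≟ a
      ... | yes refl = trans (merge-joins (component l) a b) (merge-⊇ (component l) (step l b))
      ... | no _ with c ≟ b
      ...   | yes refl = trans (≡.sym (merge-joins (component l) a b)) (merge-⊇ (component l) (step l a))
      ...   | no _     = merge-⊇ (component l) (step l c)

    -- Twice the genus of the map with vertices σ and edges l is at least k.
    Genus≥ : ℕ → List (A × A) → Set
    Genus≥ k l = k + (classes (cycles (face l)) + classes (cycles σ)) ≤ length l + 2 * classes (component l)

    -- Within a component there is at most one new face against one new edge. Between two components
    -- the ends also lie in different faces, so a face is lost; together with the new edge this pays
    -- for the lost component, which counts twice.
    genus-∷ : ∀ k a b l → Genus≥ k l → Genus≥ k ((a , b) ∷ l)
    genus-∷ k a b l h with rep (component l) a ≟ rep (component l) b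
    ... | yes a~b = begin
          k + (classes (cycles (face ((a , b) ∷ l))) + s) ≤⟨ +-monoʳ-≤ k
                (+-monoˡ-≤ s (cycles-transpose (face-injective l))) ⟩
          k + suc (classes (cycles (face l)) + s)         ≡⟨ +-suc k _ ⟩
          suc (k + (classes (cycles (face l)) + s))       ≤⟨ s≤s h ⟩
          suc (length l + 2 * classes (component l))      ≤⟨ s≤s (+-monoʳ-≤ (length l) (*-monoʳ-≤ 2
              (classes-antitone (component ((a , b) ∷ l)) (component l)
                (merge-elim _ (~-isEquivalence (component l)) (component l) id a~b)))) ⟩
          suc (length l + 2 * classes (component ((a , b) ∷ l))) ∎
      where
      open ≤-Reasoning
      s = classes (cycles σ)
    ... | no a≁b = ≤-pred (begin
          suc (k + (classes (cycles (face ((a , b) ∷ l))) + s)) ≡⟨ +-suc k _ ⟨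
          k + suc (classes (cycles (face ((a , b) ∷ l))) + s)   ≤⟨ +-monoʳ-≤ k (+-monoˡ-≤ s
              (cycles-joined (face-injective l) (a≁b ∘ face⊆component l))) ⟩
          k + (classes (cycles (face l)) + s)                   ≤⟨ h ⟩
          length l + 2 * classes (component l)
                ≤⟨ +-monoʳ-≤ (length l) (*-monoʳ-≤ 2 (classes≤1+merge (component l) a b)) ⟩
          length l + 2 * suc (classes (component ((a , b) ∷ l))) ≡⟨ arith (length l) _ ⟩
          suc (suc (length l + 2 * classes (component ((a , b) ∷ l)))) ∎)
      where
      open ≤-Reasoning
      s = classes (cycles σ)
      arith : ∀ x y → x + 2 * suc y ≡ suc (suc (x + 2 * y))
      arith = solve-∀

    genus-[] : Genus≥ 0 []
    genus-[] = ≤-reflexive (cong (classes (cycles σ) +_) (≡.sym (+-identityʳ _)))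

    genus-++ : ∀ k l′ {l} → Genus≥ k l → Genus≥ k (l′ ++ l)
    genus-++ k []            h = h
    genus-++ k ((a , b) ∷ l′) h = genus-∷ k a b (l′ ++ _) (genus-++ k l′ h)

    genus≥0 : ∀ l → Genus≥ 0 l
    genus≥0 []            = genus-[]
    genus≥0 ((a , b) ∷ l) = genus-∷ 0 a b l (genus≥0 l)

    -- The components stay the same while two faces fuse: one face fewer and one edge more open a
    -- gap of two.
    genus≥2 : ∀ {a b l} → ⟨ component l ⟩ a ~ b → ¬ ⟨ cycles (face l) ⟩ a ~ b → Genus≥ 2 ((a , b) ∷ l)
    genus≥2 {a} {b} {l} a~b a≁b = s≤s (begin
      suc (classes (cycles (face ((a , b) ∷ l))) + s) ≤⟨ +-monoˡ-≤ s (cycles-joined (face-injective l) a≁b) ⟩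
      classes (cycles (face l)) + s                   ≤⟨ genus≥0 l ⟩
      length l + 2 * classes (component l)            ≤⟨ +-monoʳ-≤ (length l) (*-monoʳ-≤ 2
              (classes-antitone (component ((a , b) ∷ l)) (component l)
                (merge-elim _ (~-isEquivalence (component l)) (component l) id a~b))) ⟩
      length l + 2 * classes (component ((a , b) ∷ l)) ∎)
      where
      open ≤-Reasoning
      s = classes (cycles σ)

-- Darts and rotation systems

allF-intro : ∀ {n} {p : Fin n → Bool} → (∀ i → p i ≡ true) → allF p ≡ true
allF-intro {zero}  h = refl
allF-intro {suc n} h = true∧ (h fz) (allF-intro (h ∘ fs))

allF-elim : ∀ {n} {p : Fin n → Bool} → allF p ≡ true → ∀ i → p i ≡ true
allF-elim h fz     = proj₁ (∧-true h)
allF-elim h (fs i) = allF-elim (proj₂ (∧-true h)) i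

anyF-elim : ∀ {n} {p : Fin n → Bool} → anyF p ≡ true → ∃ λ i → p i ≡ true
anyF-elim {suc n} {p} h with p fz in eq
... | true  = fz , eq
... | false = case anyF-elim h of λ { (i , pi) → fs i , pi }

allBelow-elim : ∀ N {p} → allBelow N p ≡ true → ∀ {k} → k < N → p k ≡ true
allBelow-elim (suc N) {p} h {k} (s≤s k≤N) with m≤n⇒m<n∨m≡n k≤N
... | inj₁ k<N  = allBelow-elim N (proj₁ (∧-true h)) k<N
... | inj₂ refl = proj₂ (∧-true {a = allBelow N p} h)

≤ᵇ-true : ∀ {m n} → m ≤ n → (m ≤ᵇ n) ≡ true
≤ᵇ-true {m} {n} h with m ≤ᵇ n | ≤⇒≤ᵇ h
... | true | _ = refl

≤ᵇ-true⁻ : ∀ {m n} → (m ≤ᵇ n) ≡ true → m ≤ n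
≤ᵇ-true⁻ {m} {n} eq = ≤ᵇ⇒≤ m n (subst T (≡.sym eq) tt)

<ᵇ-true : ∀ {m n} → m < n → (m <ᵇ n) ≡ true
<ᵇ-true {m} {n} h with m <ᵇ n | <⇒<ᵇ h
... | true | _ = refl

<ᵇ-true⁻ : ∀ {m n} → (m <ᵇ n) ≡ true → m < n
<ᵇ-true⁻ {m} {n} eq = <ᵇ⇒< m n (subst T (≡.sym eq) tt)

least : ∀ {n} (p : Fin n → Bool) {i} → p i ≡ true →
        ∃ λ r → p r ≡ true × (∀ w → p w ≡ true → toℕ r ≤ toℕ w)
least {suc n} p {i} pi with p fz in eq
... | true  = fz , eq , λ _ _ → z≤n
least {suc n} p {fz}   pi | false = case trans (≡.sym eq) pi of λ ()
least {suc n} p {fs i} pi | false =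
  let r , pr , min = least (p ∘ fs) pi
  in fs r , pr , λ { fz pw → case trans (≡.sym eq) pw of λ () ; (fs w) pw → s≤s (min w pw) }

Dart : ℕ → Set
Dart n = Fin n × Fin n

darts : ∀ n → Finite (Dart n)
darts n = record
  { size       = n * n
  ; enum       = remQuot {n} n
  ; index      = uncurry combine
  ; enum-index = λ { (u , v) → Fin.remQuot-combine u v }
  ; index-enum = Fin.combine-remQuot {n} n
  ; _≟_        = ≡-dec Fin._≟_ Fin._≟_
  }

∑-darts : ∀ {n} (f : Dart n → ℕ) → Finite.∑ (darts n) f ≡ sumF (λ u → sumF (λ v → f (u , v)))
∑-darts {n} f = trans (sumF-combine n n (f ∘ remQuot {n} n))
  (sumF-cong (λ u → sumF-cong (λ v → cong f (Fin.remQuot-combine {n} {n} u v))))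

module _ {n : ℕ} (G : Graph n) where

  open Finite (darts n)

  Adj : Dart n → Bool
  Adj (u , v) = adj G u v

  adj-swap : ∀ {u v} → adj G u v ≡ true → adj G v u ≡ true
  adj-swap {u} {v} h = trans (≡.sym (sym G u v)) h

  adj-≢ : ∀ {u v} → adj G u v ≡ true → ¬ u ≡ v
  adj-≢ {u} h refl = case trans (≡.sym h) (irrefl G u) of λ ()

  neighbour : Fin n → Fin n
  neighbour u with Fin.any? (λ v → adj G u v Bool.≟ true)
  ... | yes (v , _) = v
  -- As `u` is not its own neighbour, `adj G u (neighbour u)` becomes a test for having a neighbour
  -- at all.
  ... | no _        = u

  neighbour-adj : ∀ {u v} → adj G u v ≡ true → adj G u (neighbour u) ≡ true
  neighbour-adj {u} {v} h with Fin.any? (λ v → adj G u v Bool.≟ true)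
  ... | yes (_ , h′) = h′
  ... | no ¬h        = contradiction (v , h) ¬h

  ¬isolated : ∀ u → not (isolated G u) ≡ adj G u (neighbour u)
  ¬isolated u with adj G u (neighbour u) in eq
  ... | true = cong not (≢true⇒≡false λ deg≡0 →
        case subst (1 ≤_) (trans (≡.sym (count≡sumF (adj G u))) (≡ᵇ⇒≡ _ 0 (subst T (≡.sym deg≡0) tt)))
               (∃⇒1≤sumF (⟦_⟧ ∘ adj G u) (neighbour u) (≤-reflexive (cong ⟦_⟧ (≡.sym eq)))) of λ ())
  ... | false = cong (λ d → not (d ≡ᵇ 0)) (trans (count≡sumF (adj G u)) (trans (sumF-cong none) (sumF-0 n)))
    where
    none : ∀ v → ⟦ adj G u v ⟧ ≡ 0
    none v = cong ⟦_⟧ (≢true⇒≡false λ h → case trans (≡.sym eq) (neighbour-adj h) of λ ())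

  reach-closed : {X : Fin n → Set} → (∀ {u w} → X u → adj G u w ≡ true → X w) →
                 ∀ k {u w} → X u → reach G k u w ≡ true → X w
  reach-closed closed zero {u} {w} Xu h with u Fin.≟ w
  ... | yes refl = Xu
  reach-closed closed (suc k) {u} {w} Xu h with reach G k u w in eq
  ... | true  = reach-closed closed k Xu eq
  ... | false with anyF-elim h
  ...   | x , hx = closed (reach-closed closed k Xu (proj₁ (∧-true hx))) (proj₂ (∧-true {a = reach G k u x} hx))

  -- All that is reachable from `r` stays in the closed set `X`, which may be a union of several
  -- components; `some-component` takes all nonisolated vertices.
  compRep-intro : {X : Fin n → Set} → (∀ {u w} → X u → adj G u w ≡ true → X w) →
                  ∀ {r} → X r → (∀ w → X w → toℕ r ≤ toℕ w) → compRep G r ≡ true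
  compRep-intro closed {r} Xr min = allF-intro below
    where
    below : ∀ w → not (connected G r w) ∨ (toℕ r ≤ᵇ toℕ w) ≡ true
    below w with connected G r w in eq
    ... | false = refl
    ... | true  = ≤ᵇ-true (min w (reach-closed closed n Xr eq))

  nonadjacent : ℕ
  nonadjacent = # (not ∘ Adj)

  -- A system of representatives among the darts: every nonadjacent pair, and one dart at each
  -- nonisolated vertex allowed by `w`. With `w` constantly true it represents the vertices, with
  -- `compRep` the components.
  oneDartPer : (Fin n → Bool) → Dart n → Bool
  oneDartPer w (u , v) = not (adj G u v) ∨ (w u ∧ does (neighbour u Fin.≟ v))

  #oneDartPer : ∀ w → # (oneDartPer w) ≡ nonadjacent + count (λ u → w u ∧ not (isolated G u))
  #oneDartPer w = begin
    # (oneDartPer w)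
      ≡⟨ ∑-darts (⟦_⟧ ∘ oneDartPer w) ⟩
    sumF (λ u → sumF (λ v → ⟦ oneDartPer w (u , v) ⟧))
      ≡⟨ sumF-cong (λ u → trans (sumF-cong (split u)) (sumF-+ (λ v → ⟦ not (adj G u v) ⟧) _)) ⟩
    sumF (λ u → sumF (λ v → ⟦ not (adj G u v) ⟧) + sumF (λ v → if does (neighbour u Fin.≟ v) then ⟦ w u
          ∧ adj G u v ⟧ else 0))
      ≡⟨ sumF-+ (λ u → sumF (λ v → ⟦ not (adj G u v) ⟧)) _ ⟩
    sumF (λ u → sumF (λ v → ⟦ not (adj G u v) ⟧)) + sumF (λ u → sumF
          (λ v → if does (neighbour u Fin.≟ v) then ⟦ w u ∧ adj G u v ⟧ else 0))
      ≡⟨ cong₂ _+_ (≡.sym (∑-darts (⟦_⟧ ∘ not ∘ Adj)))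
           (trans (sumF-cong (λ u → trans (sumF-δ (neighbour u) (λ v → ⟦ w u ∧ adj G u v ⟧))
                                          (cong (λ b → ⟦ w u ∧ b ⟧) (≡.sym (¬isolated u)))))
                  (≡.sym (count≡sumF (λ u → w u ∧ not (isolated G u))))) ⟩
    nonadjacent + count (λ u → w u ∧ not (isolated G u)) ∎
    where
    open ≡-Reasoning
    split : ∀ u v → ⟦ oneDartPer w (u , v) ⟧ ≡
              ⟦ not (adj G u v) ⟧ + (if does (neighbour u Fin.≟ v) then ⟦ w u ∧ adj G u v ⟧ else 0)
    split u v with does (neighbour u Fin.≟ v) | adj G u v | w u
    ... | true  | true  | true  = refl
    ... | true  | true  | false = refl
    ... | true  | false | true  = refl
    ... | true  | false | false = refl
    ... | false | true  | true  = refl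
    ... | false | true  | false = refl
    ... | false | false | true  = refl
    ... | false | false | false = refl

  dartKey-injective : ∀ {d d′} → dartKey G d ≡ dartKey G d′ → d ≡ d′
  dartKey-injective {u , v} {u′ , v′} eq = cong₂ _,_
    (Fin.combine-injectiveˡ u v u′ v′ eq′) (Fin.combine-injectiveʳ u v u′ v′ eq′)
    where
    key : ∀ x y → toℕ (combine x y) ≡ dartKey G (x , y)
    key x y = trans (Fin.toℕ-combine x y) (cong (_+ toℕ y) (*-comm n (toℕ x)))
    eq′ : combine u v ≡ combine u′ v′
    eq′ = Fin.toℕ-injective (trans (key u v) (trans eq (≡.sym (key u′ v′))))

module Rotation {n : ℕ} (G : Graph n) (rot : Fin n → Fin n → Fin n) (isRot : IsRotation G rot) where

  open Finite (darts n)
  open Partitions (darts n)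
  open IsRotation isRot

  rot-injective : ∀ {u v w} → adj G u v ≡ true → adj G u w ≡ true → rot u v ≡ rot u w → v ≡ w
  rot-injective {u} {v} {w} hv hw = periodic-injective (rot u) (proj₁ (back hv)) (proj₁ (back hw))
        (proj₂ (back hv)) (proj₂ (back hw))
    where
    back : ∀ {x} → adj G u x ≡ true → ∃ λ k → iter (rot u) (suc k) x ≡ x
    back {x} h = let k , eq = cyclic u (rot u x) x (closed u x h) h in k , trans (iter-suc (rot u) k x) eq

  -- Pairs that are not darts are fixed, so they contribute the same number to every count of orbits.
  σ : Dart n → Dart n
  σ (u , v) = if adj G u v then (u , rot u v) else (u , v)

  σ-adj : ∀ {u v} → adj G u v ≡ true → σ (u , v) ≡ (u , rot u v)
  σ-adj h rewrite h = refl

  σ-nonadj : ∀ {d} → Adj G d ≡ false → σ d ≡ d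
  σ-nonadj {u , v} h rewrite h = refl

  Adj-σ : ∀ d → Adj G (σ d) ≡ Adj G d
  Adj-σ (u , v) with adj G u v in eq
  ... | true  = closed u v eq
  ... | false = eq

  proj₁-σ : ∀ d → proj₁ (σ d) ≡ proj₁ d
  proj₁-σ (u , v) with adj G u v
  ... | true  = refl
  ... | false = refl

  σ-injective : Injective _≡_ _≡_ σ
  σ-injective {u , v} {u′ , v′} eq with trans (≡.sym (proj₁-σ (u , v))) (trans (cong proj₁ eq) (proj₁-σ (u′ , v′)))
  ... | refl with adj G u v in h | adj G u v′ in h′
  ...   | true  | true  = cong (u ,_) (rot-injective h h′ (proj₂ (,-injective eq)))
  ...   | false | false = eq
  ...   | true  | false = case trans (≡.sym (closed u v h)) (trans (cong (Adj G) eq) h′) of λ ()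
  ...   | false | true  = case trans (≡.sym h) (trans (cong (Adj G) eq) (closed u v′ h′)) of λ ()

  open Euler σ-injective public

  -- `σ` preserves the first vertex and fixes nonadjacent pairs, so the chosen darts lie on
  -- different cycles. Isolated vertices have no dart, hence the last summand.
  vertices≤ : nonadjacent G + n ≤ classes (cycles σ) + #isolated G
  vertices≤ = begin
    nonadjacent G + n
      ≡⟨ cong (nonadjacent G +_) (trans (≡.sym (trans (sumF-const n 1) (*-identityʳ n))) (sumF-cong split)) ⟩
    nonadjacent G + sumF (λ u → ⟦ not (isolated G u) ⟧ + ⟦ isolated G u ⟧)
      ≡⟨ cong (nonadjacent G +_) (trans (sumF-+ (λ u → ⟦ not (isolated G u) ⟧) _)
           (≡.sym (cong₂ _+_ (count≡sumF (not ∘ isolated G)) (count≡sumF (isolated G))))) ⟩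
    nonadjacent G + (count (not ∘ isolated G) + #isolated G)
      ≡⟨ +-assoc (nonadjacent G) _ _ ⟨
    nonadjacent G + count (not ∘ isolated G) + #isolated G
      ≡⟨ cong (_+ #isolated G) (#oneDartPer G (λ _ → true)) ⟨
    # (oneDartPer G (λ _ → true)) + #isolated G
      ≤⟨ +-monoˡ-≤ (#isolated G) (#≤classes (cycles σ) (oneDartPer G (λ _ → true)) distinct) ⟩
    classes (cycles σ) + #isolated G ∎
    where
    open ≤-Reasoning
    split : ∀ u → 1 ≡ ⟦ not (isolated G u) ⟧ + ⟦ isolated G u ⟧
    split u with isolated G u
    ... | true  = refl
    ... | false = refl
    SameVertex : Dart n → Dart n → Set
    SameVertex d d′ = proj₁ d ≡ proj₁ d′ × Adj G d ≡ Adj G d′ × (Adj G d ≡ false → d ≡ d′)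
    sameVertex-eq : IsEquivalence SameVertex
    sameVertex-eq = record
      { refl  = refl , refl , λ _ → refl
      ; sym   = λ { (a , b , c) → ≡.sym a , ≡.sym b , λ h → ≡.sym (c (trans b h)) }
      ; trans = λ { (a , b , c) (a′ , b′ , c′) →
          trans a a′ , trans b b′ , λ h → trans (c h) (c′ (trans (≡.sym b) h)) }
      }
    distinct : ∀ d d′ → oneDartPer G (λ _ → true) d ≡ true → oneDartPer G (λ _ → true) d′ ≡ true →
               ⟨ cycles σ ⟩ d ~ d′ → d ≡ d′
    distinct (u , v) (u′ , v′) h h′ d~d′
      with cycles-elim σ SameVertex sameVertex-eq
             (λ d → ≡.sym (proj₁-σ d) , ≡.sym (Adj-σ d) , λ na → ≡.sym (σ-nonadj na)) d~d′
    ... | refl , same , fixed with adj G u v | adj G u v′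
    ...   | false | _    = fixed refl
    ...   | true  | true = cong (u ,_) (trans (≡.sym (does⇒ (neighbour G u Fin.≟ v) h))
          (does⇒ (neighbour G u Fin.≟ v′) h′))
    distinct (u , v) (u′ , v′) h h′ d~d′ | refl , () , fixed | true | false

  module _ {f : Dart n → Dart n} (inj : Injective _≡_ _≡_ f) (onAdj : ∀ d → Adj G d ≡ true
        → f d ≡ facePerm G rot d) where

    private
      Adj-f : ∀ d → Adj G d ≡ true → Adj G (f d) ≡ true
      Adj-f (u , v) h = trans (cong (Adj G) (onAdj (u , v) h)) (closed v u (adj-swap G h))
      Adj-iter : ∀ k {d} → Adj G d ≡ true → Adj G (iter f k d) ≡ true
      Adj-iter zero    h = h
      Adj-iter (suc k) h = Adj-f _ (Adj-iter k h)
      iter-f : ∀ k {d} → Adj G d ≡ true → iter f k d ≡ iter (facePerm G rot) k d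
      iter-f zero    h = refl
      iter-f (suc k) h = trans (onAdj _ (Adj-iter k h)) (cong (facePerm G rot) (iter-f k h))
      minimal : ∀ d d′ → uncurry (faceRep G rot) d ≡ true → Orbit inj d d′ → dartKey G d ≤ dartKey G d′
      minimal d _ h (k , refl) with iter-bounded inj d k
      ... | j , j<N , eq = subst (λ z → dartKey G d ≤ dartKey G z)
              (trans (≡.sym (iter-f j (proj₁ (∧-true h)))) eq)
              (≤ᵇ-true⁻ (allBelow-elim (n * n) (proj₂ (∧-true {a = Adj G d} h)) j<N))

    faceRep-unique : ∀ {d d′} → uncurry (faceRep G rot) d ≡ true → uncurry (faceRep G rot) d′ ≡ true →
                     Orbit inj d d′ → d ≡ d′
    faceRep-unique h h′ o = dartKey-injective G (≤-antisym (minimal _ _ h o) (minimal _ _ h′ (orbit-sym inj o)))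

  -- The minimal darts of the face orbits and the nonadjacent pairs lie on pairwise different cycles
  -- of `f`.
  faces≤ : ∀ {f} → Injective _≡_ _≡_ f → (∀ d → Adj G d ≡ true → f d ≡ facePerm G rot d) →
           (∀ d → Adj G d ≡ false → f d ≡ d) → nonadjacent G + faces G rot ≤ classes (cycles f)
  faces≤ {f} inj onAdj onNonadj = begin
    nonadjacent G + faces G rot
      ≡⟨ cong (nonadjacent G +_) (trans (sumF-cong (λ u → count≡sumF (faceRep G rot u)))
            (≡.sym (∑-darts (⟦_⟧ ∘ uncurry (faceRep G rot))))) ⟩
    nonadjacent G + # (uncurry (faceRep G rot))
      ≡⟨ sumF-+ (λ i → ⟦ not (Adj G (enum i)) ⟧) _ ⟨
    ∑ (λ d → ⟦ not (Adj G d) ⟧ + ⟦ uncurry (faceRep G rot) d ⟧)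
      ≡⟨ sumF-cong (λ i → split (enum i)) ⟩
    # p
      ≤⟨ #≤classes (cycles f) p distinct ⟩
    classes (cycles f) ∎
    where
    open ≤-Reasoning
    p : Dart n → Bool
    p d = not (Adj G d) ∨ uncurry (faceRep G rot) d
    split : ∀ d → ⟦ not (Adj G d) ⟧ + ⟦ uncurry (faceRep G rot) d ⟧ ≡ ⟦ p d ⟧
    split (u , v) with adj G u v
    ... | true  = refl
    ... | false = refl
    iter-nonadj : ∀ k {d} → Adj G d ≡ false → iter f k d ≡ d
    iter-nonadj zero    h = refl
    iter-nonadj (suc k) h = trans (cong f (iter-nonadj k h)) (onNonadj _ h)
    distinct : ∀ d d′ → p d ≡ true → p d′ ≡ true → ⟨ cycles f ⟩ d ~ d′ → d ≡ d′
    distinct d d′ h h′ d~d′ with Adj G d in eq | Adj G d′ in eq′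
    ... | false | _ = let k , e = cycles⇒orbit inj d~d′ in trans (≡.sym (iter-nonadj k eq)) e
    ... | true | false = let k , e = cycles⇒orbit inj (≡.sym d~d′) in trans (≡.sym e) (iter-nonadj k eq′)
    ... | true | true = faceRep-unique inj onAdj (true∧ eq h) (true∧ eq′ h′) (cycles⇒orbit inj d~d′)

  σ-transitive : ∀ P → (∀ d → ⟨ P ⟩ d ~ σ d) → ∀ {u v w} → adj G u v ≡ true → adj G u w ≡ true → ⟨ P ⟩ (u , v) ~
        (u , w)
  σ-transitive P step {u} {v} {w} hv hw = let k , eq = cyclic u v w hv hw in go k hv eq
    where
    go : ∀ k {v} → adj G u v ≡ true → iter (rot u) k v ≡ w → ⟨ P ⟩ (u , v) ~ (u , w)
    go zero    hv refl = refl
    go (suc k) {v} hv eq = trans (trans (step (u , v)) (cong (Partition.rep P) (σ-adj hv)))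
                         (go k (closed u v hv) (trans (≡.sym (iter-suc (rot u) k v)) eq))

  -- A class of darts is closed under turning and crossing, so the vertices it visits are closed
  -- under adjacency; the least of them is a `compRep`, and one of its darts represents the class.
  components≤ : ∀ P → (∀ d → ⟨ P ⟩ d ~ σ d) → (∀ d → Adj G d ≡ true → ⟨ P ⟩ d ~ swap d) →
                (∀ {d d′} → ⟨ P ⟩ d ~ d′ → Adj G d ≡ Adj G d′) →
                classes P ≤ nonadjacent G + #nontrivComps G
  components≤ P ~σ ~swap ~Adj = ≤-trans (classes≤# P (oneDartPer G (compRep G)) cover)
        (≤-reflexive (#oneDartPer G (compRep G)))
    where
    cover : ∀ d → ∃ λ d′ → oneDartPer G (compRep G) d′ ≡ true × ⟨ P ⟩ d ~ d′
    cover (u , v) with adj G u v in eq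
    ... | false = (u , v) , cong (λ b → not b ∨ (compRep G u ∧ does (neighbour G u Fin.≟ v))) eq , refl
    ... | true = (r , neighbour G r) , chosen , ≡.sym (proj₂ Xr)
      where
      X : Fin n → Set
      -- All darts at a vertex are equivalent, so one of them decides whether the vertex belongs to
      -- the class of `(u , v)`.
      X w = adj G w (neighbour G w) ≡ true × ⟨ P ⟩ (w , neighbour G w) ~ (u , v)
      X? : Fin n → Bool
      X? w = does (Partition.rep P (w , neighbour G w) ≟ Partition.rep P (u , v))
      X?⇒X : ∀ w → X? w ≡ true → X w
      X?⇒X w h = let h′ = does⇒ (_ ≟ _) h in trans (~Adj h′) eq , h′
      X-closed : ∀ {x y} → X x → adj G x y ≡ true → X y
      X-closed {x} {y} (hx , x~) h = neighbour-adj G (adj-swap G h) ,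
        trans (σ-transitive P ~σ (neighbour-adj G (adj-swap G h)) (adj-swap G h))
          (trans (~swap (y , x) (adj-swap G h)) (trans (σ-transitive P ~σ h (neighbour-adj G h)) x~))
      found = least X? {u} (dec-true (_ ≟ _) (σ-transitive P ~σ (neighbour-adj G eq) eq))
      r = proj₁ found
      Xr : X r
      Xr = X?⇒X r (proj₁ (proj₂ found))
      chosen : oneDartPer G (compRep G) (r , neighbour G r) ≡ true
      chosen rewrite proj₁ Xr = true∧
        (compRep-intro G X-closed Xr (λ w Xw → proj₂ (proj₂ found) w (dec-true (_ ≟ _) (proj₂ Xw))))
        (dec-true (neighbour G r Fin.≟ neighbour G r) refl)

module _ {A : Set} (fin : Finite A) where

  open Finite fin

  select : (A → Bool) → List A
  select p = filter (λ a → p a Bool.≟ true) (tabulate enum)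

  length-select : ∀ p → length (select p) ≡ # p
  length-select p = go enum
    where
    go : ∀ {k} (f : Fin k → A) → length (filter (λ a → p a Bool.≟ true) (tabulate f)) ≡ sumF (⟦_⟧ ∘ p ∘ f)
    go {zero}  f = refl
    go {suc k} f with p (f fz)
    ... | true  = cong suc (go (f ∘ fs))
    ... | false = go (f ∘ fs)

  ∈-select⁺ : ∀ p {a} → p a ≡ true → a ∈ select p
  ∈-select⁺ p {a} pa = ∈-filter⁺ (λ a → p a Bool.≟ true)
    (subst (_∈ tabulate enum) (enum-index a) (∈-tabulate⁺ (index a))) pa

  ∈-select⁻ : ∀ p {a} → a ∈ select p → p a ≡ true
  ∈-select⁻ p m = proj₂ (∈-filter⁻ (λ a → p a Bool.≟ true) {xs = tabulate enum} m)

  select-unique : ∀ p → Unique (select p)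
  select-unique p = Unique.filter⁺ (λ a → p a Bool.≟ true) (Unique.tabulate⁺ enum-injective)

-- Subgraphs of a plane graph as lists of edges

edge : ∀ {n} → Dart n → Dart n × Dart n
edge d = d , swap d

Increasing : ∀ {n} → Dart n → Set
Increasing (u , v) = toℕ u < toℕ v

swap-not-increasing : ∀ {n} {d : Dart n} → Increasing d → ¬ Increasing (swap d)
swap-not-increasing = <-asym

module EdgeLists {n : ℕ} (G : Graph n) (rot : Fin n → Fin n → Fin n) (isRot : IsRotation G rot) where

  open Finite (darts n)
  open Partitions (darts n)
  open IsRotation isRot
  open Rotation G rot isRot

  face-off : ∀ ds {d} → d ∉ ds → swap d ∉ ds → face (map edge ds) d ≡ σ d
  face-off []       d∉ d̄∉ = refl
  face-off (e ∷ ds) d∉ d̄∉ = trans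
    (cong (face (map edge ds)) (transpose-other (λ { refl → d∉ (here refl) }) (λ { refl → d̄∉ (here refl) })))
    (face-off ds (d∉ ∘ there) (d̄∉ ∘ there))

  -- Increasing darts name each edge once, so the transpositions are disjoint: exactly one of them
  -- moves `d`, and the others fix both `d` and `swap d`.
  face-on : ∀ {ds} → Unique ds → (∀ {d} → d ∈ ds → Increasing d) →
            ∀ {d} → d ∈ ds ⊎ swap d ∈ ds → face (map edge ds) d ≡ σ (swap d)
  face-on {[]}     _ _ (inj₁ ())
  face-on {[]}     _ _ (inj₂ ())
  face-on {e ∷ ds} (e≢ ∷ uniq) inc {d} m = go (d ≟ e) (d ≟ swap e)
    where
    e∉ : e ∉ ds
    e∉ m = All.lookup e≢ m refl
    ē∉ : swap e ∉ ds
    ē∉ m = swap-not-increasing {d = e} (inc (here refl)) (inc (there m))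
    go : Dec (d ≡ e) → Dec (d ≡ swap e) → face (map edge (e ∷ ds)) d ≡ σ (swap d)
    go (yes refl) _ = trans (cong (face (map edge ds)) (transpose-left e (swap e))) (face-off ds ē∉ e∉)
    go (no _) (yes refl) = trans (cong (face (map edge ds)) (transpose-right e (swap e))) (face-off ds e∉ ē∉)
    go (no d≢e) (no d≢ē) = trans (cong (face (map edge ds)) (transpose-other d≢e d≢ē))
      (face-on uniq (inc ∘ there) (rest m))
      where
      rest : d ∈ e ∷ ds ⊎ swap d ∈ e ∷ ds → d ∈ ds ⊎ swap d ∈ ds
      rest (inj₁ (here eq)) = contradiction eq d≢e
      rest (inj₁ (there m)) = inj₁ m
      rest (inj₂ (here eq)) = contradiction (cong swap eq) d≢ē
      rest (inj₂ (there m)) = inj₂ m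

  canonical : Dart n → Bool
  canonical (u , v) = adj G u v ∧ (toℕ u <ᵇ toℕ v)

  #canonical : # canonical ≡ edges G
  #canonical = trans (∑-darts (⟦_⟧ ∘ canonical)) (sumF-cong (λ u → ≡.sym (count≡sumF (λ v → canonical (u , v)))))

  canonical-increasing : ∀ {d} → canonical d ≡ true → Increasing d
  canonical-increasing {u , v} h = <ᵇ-true⁻ (proj₂ (∧-true {a = adj G u v} h))

  orient : ∀ d → Adj G d ≡ true → canonical d ≡ true ⊎ canonical (swap d) ≡ true
  orient (u , v) h with <-cmp (toℕ u) (toℕ v)
  ... | tri< lt _ _ = inj₁ (true∧ h (<ᵇ-true lt))
  ... | tri≈ _ eq _ = contradiction (Fin.toℕ-injective eq) (adj-≢ G h)
  ... | tri> _ _ gt = inj₂ (true∧ (adj-swap G h) (<ᵇ-true gt))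

  Adj-canonical : ∀ {d} → canonical d ≡ true → Adj G d ≡ true
  Adj-canonical h = proj₁ (∧-true h)

  module Sub (S : Dart n → Bool) (S-swap : ∀ d → S (swap d) ≡ S d) where

    subEdges : List (Dart n × Dart n)
    subEdges = map edge (select (darts n) (λ d → canonical d ∧ S d))

    face-S : ∀ {d} → Adj G d ≡ true → S d ≡ true → face subEdges d ≡ σ (swap d)
    face-S {d} h Sd = face-on (select-unique (darts n) _)
      (λ {e} m → canonical-increasing (proj₁ (∧-true (∈-select⁻ (darts n) _ m))))
      (member (orient d h))
      where
      member : canonical d ≡ true ⊎ canonical (swap d) ≡ true → _
      member (inj₁ c) = inj₁ (∈-select⁺ (darts n) _ (true∧ c Sd))
      member (inj₂ c) = inj₂ (∈-select⁺ (darts n) _ (true∧ c (trans (S-swap d) Sd)))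

    face-¬S : ∀ {d} → S d ≡ false → face subEdges d ≡ σ d
    face-¬S {d} Sd = face-off (select (darts n) (λ d → canonical d ∧ S d))
      (λ m → case trans (≡.sym Sd) (in-S d m) of λ ())
      (λ m → case trans (≡.sym Sd) (trans (≡.sym (S-swap d)) (in-S (swap d) m)) of λ ())
      where
      in-S : ∀ e → e ∈ select (darts n) (λ d → canonical d ∧ S d) → S e ≡ true
      in-S e m = proj₂ (∧-true {a = canonical e} (∈-select⁻ (darts n) _ m))

    component-S : ∀ {d} → Adj G d ≡ true → S d ≡ true → ⟨ component subEdges ⟩ d ~ swap d
    component-S {d} h Sd with orient d h
    ... | inj₁ c = component-∋ (∈-map⁺ edge (∈-select⁺ (darts n) _ (true∧ c Sd)))
    ... | inj₂ c = ≡.sym (component-∋ (∈-map⁺ edge (∈-select⁺ (darts n) _ (true∧ c (trans (S-swap d) Sd)))))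

  module _ (euler : n + faces G rot ≡ edges G + 2 * #nontrivComps G + #isolated G) where

    -- The Euler equation of the embedding leaves no gap. The three comparisons go the way the
    -- contradiction consumes them: at least so many vertices and faces, at most so many components.
    genus≱2 : ∀ {ds} → Unique ds → (∀ {d} → d ∈ ds → canonical d ≡ true) →
              (∀ {d} → canonical d ≡ true → d ∈ ds) → length ds ≡ edges G → ¬ Genus≥ 2 (map edge ds)
    genus≱2 {ds} uniq canon complete len genus = <-irrefl refl (begin-strict
      (M + n) + (M + F)                     <⟨ m<n+m _ {2} (s≤s z≤n) ⟩
      2 + ((M + n) + (M + F))               ≤⟨ +-monoʳ-≤ 2 (+-mono-≤ vertices≤
            (faces≤ (face-injective (map edge ds)) onAdj onNonadj)) ⟩
      2 + ((s + I) + f)                     ≡⟨ arith₁ s I f ⟩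
      2 + (f + s) + I                       ≤⟨ +-monoˡ-≤ I genus ⟩
      length (map edge ds) + 2 * classes K + I ≤⟨ +-monoˡ-≤ I
            (+-mono-≤ (≤-reflexive (trans (List.length-map edge ds) len))
                                                (*-monoʳ-≤ 2 (components≤ K (component-σ
                                                      (map edge ds)) ~swap ~Adj))) ⟩
      edges G + 2 * (M + #nontrivComps G) + I ≡⟨ arith₂ (edges G) M (#nontrivComps G) I ⟩
      (M + M) + (edges G + 2 * #nontrivComps G + I) ≡⟨ cong ((M + M) +_) euler ⟨
      (M + M) + (n + F)                     ≡⟨ +-interchange M M n F ⟩
      (M + n) + (M + F)                     ∎)
      where
      open ≤-Reasoning
      M = nonadjacent G
      F = faces G rot
      I = #isolated G
      K = component (map edge ds)
      s = classes (cycles σ)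
      f = classes (cycles (face (map edge ds)))
      arith₁ : ∀ s I f → 2 + ((s + I) + f) ≡ 2 + (f + s) + I
      arith₁ = solve-∀
      arith₂ : ∀ E M C I → E + 2 * (M + C) + I ≡ (M + M) + (E + 2 * C + I)
      arith₂ = solve-∀
      either : ∀ d → Adj G d ≡ true → d ∈ ds ⊎ swap d ∈ ds
      either d h with orient d h
      ... | inj₁ c = inj₁ (complete c)
      ... | inj₂ c = inj₂ (complete c)
      onAdj : ∀ d → Adj G d ≡ true → face (map edge ds) d ≡ facePerm G rot d
      onAdj d h = trans (face-on uniq (canonical-increasing ∘ canon) (either d h)) (σ-adj (adj-swap G h))
      nonadj∉ : ∀ {d} → Adj G d ≡ false → d ∉ ds
      nonadj∉ h m = case trans (≡.sym h) (Adj-canonical (canon m)) of λ ()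
      onNonadj : ∀ d → Adj G d ≡ false → face (map edge ds) d ≡ d
      onNonadj (u , v) h = trans (face-off ds (nonadj∉ h) (nonadj∉ (trans (sym G v u) h))) (σ-nonadj h)
      ~swap : ∀ d → Adj G d ≡ true → ⟨ K ⟩ d ~ swap d
      ~swap d h with either d h
      ... | inj₁ m = component-∋ (∈-map⁺ edge m)
      ... | inj₂ m = ≡.sym (component-∋ (∈-map⁺ edge m))
      ~Adj : ∀ {d d′} → ⟨ K ⟩ d ~ d′ → Adj G d ≡ Adj G d′
      ~Adj = component-elim (λ d d′ → Adj G d ≡ Adj G d′)
        (record { refl = refl ; sym = ≡.sym ; trans = trans }) (≡.sym ∘ Adj-σ) (map edge ds)
        (λ m → case ∈-map⁻ edge m of λ { ((u , v) , _ , refl) → sym G u v })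

    module OrientedEdge (S : Dart n → Bool) (S-swap : ∀ d → S (swap d) ≡ S d) {e : Dart n}
          (canon : canonical e ≡ true) (Se : S e ≡ false) where

      open Sub S S-swap

      others : Dart n → Bool
      others d = canonical d ∧ (not (S d) ∧ not (does (e ≟ d)))

      -- Maps are built from the end of the list. So `e` is inserted exactly when the edges of `S`
      -- are present, and the edges in front of it are added later, when `genus-++` preserves any
      -- gap already reached.
      allEdges : List (Dart n)
      allEdges = select (darts n) others ++ e ∷ select (darts n) (λ d → canonical d ∧ S d)

      allEdges-unique : Unique allEdges
      allEdges-unique = Unique.++⁺ (select-unique (darts n) others)
        (All.tabulate (λ {d} m eq → case trans (≡.sym Se) (trans (cong S eq)
              (proj₂ (∧-true {a = canonical d} (∈-select⁻ (darts n) _ m)))) of λ ())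
          ∷ select-unique (darts n) _)
        (λ { {d} (m , here refl) → case trans (cong not (≡.sym (dec-true (d ≟ d) refl)))
               (proj₂ (∧-true {a = not (S d)} (proj₂ (∧-true {a = canonical d}
                     (∈-select⁻ (darts n) others m))))) of λ ()
           ; {d} (m , there m′) → case trans (≡.sym (proj₁ (∧-true {a = not (S d)}
                 (proj₂ (∧-true {a = canonical d} (∈-select⁻ (darts n) others m))))))
               (cong not (proj₂ (∧-true {a = canonical d} (∈-select⁻ (darts n) _ m′)))) of λ () })

      allEdges-canonical : ∀ {d} → d ∈ allEdges → canonical d ≡ true
      allEdges-canonical m with ∈-++⁻ (select (darts n) others) m
      ... | inj₁ m           = proj₁ (∧-true (∈-select⁻ (darts n) others m))
      ... | inj₂ (here refl) = canon
      ... | inj₂ (there m)   = proj₁ (∧-true (∈-select⁻ (darts n) _ m))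

      allEdges-complete : ∀ {d} → canonical d ≡ true → d ∈ allEdges
      allEdges-complete {d} c with S d in Sd
      ... | true  = ∈-++⁺ʳ (select (darts n) others) (there (∈-select⁺ (darts n) _ (true∧ c Sd)))
      ... | false with e ≟ d in e≟d
      ...   | yes refl = ∈-++⁺ʳ (select (darts n) others) (here refl)
      ...   | no _     = ∈-++⁺ˡ (∈-select⁺ (darts n) others
                           (true∧ c (true∧ (cong not Sd) (cong (not ∘ does) e≟d))))

      length-allEdges : length allEdges ≡ edges G
      length-allEdges = begin
        length allEdges
          ≡⟨ List.length-++ (select (darts n) others) ⟩
        length (select (darts n) others) + suc (length (select (darts n) (λ d → canonical d ∧ S d)))
          ≡⟨ cong₂ (λ j k → j + suc k) (length-select (darts n) others)
                (length-select (darts n) (λ d → canonical d ∧ S d)) ⟩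
        # others + suc (# (λ d → canonical d ∧ S d))
          ≡⟨ cong (λ k → # others + (k + # (λ d → canonical d ∧ S d))) (#-singleton e) ⟨
        # others + (# (λ d → does (e ≟ d)) + # (λ d → canonical d ∧ S d))
          ≡⟨ cong (# others +_) (sumF-+ (λ i → ⟦ does (e ≟ enum i) ⟧) _) ⟨
        # others + ∑ (λ d → ⟦ does (e ≟ d) ⟧ + ⟦ canonical d ∧ S d ⟧)
          ≡⟨ sumF-+ (λ i → ⟦ others (enum i) ⟧) _ ⟨
        ∑ (λ d → ⟦ others d ⟧ + (⟦ does (e ≟ d) ⟧ + ⟦ canonical d ∧ S d ⟧))
          ≡⟨ sumF-cong (λ i → split (enum i)) ⟩
        # canonical
          ≡⟨ #canonical ⟩
        edges G ∎
        where
        open ≡-Reasoning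
        split : ∀ d → ⟦ others d ⟧ + (⟦ does (e ≟ d) ⟧ + ⟦ canonical d ∧ S d ⟧) ≡ ⟦ canonical d ⟧
        split d with e ≟ d
        ... | yes refl rewrite canon | Se = refl
        ... | no _ with canonical d | S d
        ...   | true  | true  = refl
        ...   | true  | false = refl
        ...   | false | _     = refl

      oriented : ⟨ component subEdges ⟩ e ~ swap e → ⟨ cycles (face subEdges) ⟩ e ~ swap e
      oriented e~ē with Partition.rep (cycles (face subEdges)) e ≟ Partition.rep (cycles (face subEdges)) (swap e)
      ... | yes same  = same
      ... | no differ = contradiction
        (subst (Genus≥ 2) (≡.sym (List.map-++ edge (select (darts n) others) _))
          (genus-++ 2 (map edge (select (darts n) others)) (genus≥2 {l = subEdges} e~ē differ)))
        (genus≱2 allEdges-unique allEdges-canonical allEdges-complete length-allEdges)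

    -- In the plane, an edge whose ends are already connected is drawn inside a single face.
    edge-in-face : ∀ S S-swap → let open Sub S S-swap in ∀ {d} → Adj G d ≡ true → S d ≡ false →
                   ⟨ component subEdges ⟩ d ~ swap d → ⟨ cycles (face subEdges) ⟩ d ~ swap d
    edge-in-face S S-swap {d} h Sd d~d̄ with orient d h
    ... | inj₁ c = OrientedEdge.oriented S S-swap c Sd d~d̄
    ... | inj₂ c = ≡.sym (OrientedEdge.oriented S S-swap c (trans (S-swap d) Sd) (≡.sym d~d̄))

-- Triangles separate

∨-true : ∀ {a b} → a ∨ b ≡ true → a ≡ true ⊎ b ≡ true
∨-true {true}  h = inj₁ refl
∨-true {false} h = inj₂ h

vertices : ∀ n → Finite (Fin n)
vertices n = record
  { size       = n
  ; enum       = id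
  ; index      = id
  ; enum-index = λ _ → refl
  ; index-enum = λ _ → refl
  ; _≟_        = Fin._≟_
  }

module _ {n : ℕ} (G : Graph n) (rot : Fin n → Fin n → Fin n) (isRot : IsRotation G rot) where

  open IsRotation isRot
  open Rotation G rot isRot using (rot-injective)

  -- The neighbours of u met when turning from a, exclusive, to b, inclusive.
  Arc : (u a b w : Fin n) → Set
  Arc u a b w = ∃ λ k → iter (rot u) (suc k) a ≡ w × (∀ j → j < k → ¬ iter (rot u) (suc j) a ≡ b)

  arc-first : ∀ {u a b} → Arc u a b (rot u a)
  arc-first = 0 , refl , λ _ ()

  arc-next : ∀ {u a b w} → Arc u a b w → ¬ w ≡ b → Arc u a b (rot u w)
  arc-next (k , refl , avoid) w≢b = suc k , refl , λ j j<1+k → case m≤n⇒m<n∨m≡n (≤-pred j<1+k) of λ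
    { (inj₁ j<k) → avoid j j<k ; (inj₂ refl) → w≢b }

  module _ {u a b : Fin n} (ha : adj G u a ≡ true) (hb : adj G u b ≡ true) (a≢b : ¬ a ≡ b) where

    -- By `cyclic`, `b` is some iterate of `a`. If the arc returned to `a`, reducing the exponent
    -- modulo its length would place `b` at `a` or strictly before the end of the arc.
    arc-∌start : ¬ Arc u a b a
    arc-∌start (k , eq , avoid) with cyclic u a b ha hb
    ... | m , refl = hit (m ℕ.% suc k) (m%n<n m (suc k)) (begin
      iter (rot u) m a
            ≡⟨ cong (λ j → iter (rot u) j a) (m≡m%n+[m/n]*n m (suc k)) ⟩
      iter (rot u) (m ℕ.% suc k + m ℕ./ suc k * suc k) a              ≡⟨ iter-+ (rot u) (m ℕ.% suc k) _ a ⟩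
      iter (rot u) (m ℕ.% suc k) (iter (rot u) (m ℕ./ suc k * suc k) a)
            ≡⟨ cong (iter (rot u) (m ℕ.% suc k)) (iter-* (rot u) (suc k) eq (m ℕ./ suc k)) ⟩
      iter (rot u) (m ℕ.% suc k) a                                  ∎)
      where
      open ≡-Reasoning
      hit : ∀ j → j < suc k → iter (rot u) m a ≡ iter (rot u) j a → ⊥
      hit zero    _         e = a≢b (≡.sym e)
      hit (suc j) (s≤s j<k) e = avoid j j<k (≡.sym e)

    -- By injectivity of the rotation, the neighbour met one step earlier would be `b`, where the
    -- arc had to stop.
    arc-∌after : ¬ Arc u a b (rot u b)
    arc-∌after (zero  , eq , _)     = a≢b (rot-injective ha hb eq)
    arc-∌after (suc k , eq , avoid) = avoid k ≤-refl (rot-injective (closed-iter (suc k)) hb eq)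
      where
      closed-iter : ∀ k → adj G u (iter (rot u) k a) ≡ true
      closed-iter zero    = ha
      closed-iter (suc k) = closed u _ (closed-iter k)

module _ {n : ℕ} where

  oneOf : (u v w : Fin n) → Fin n → Bool
  oneOf u v w z = does (z Fin.≟ u) ∨ does (z Fin.≟ v) ∨ does (z Fin.≟ w)

  oneOf-elim : ∀ {u v w} z → oneOf u v w z ≡ true → z ≡ u ⊎ z ≡ v ⊎ z ≡ w
  oneOf-elim {u} {v} {w} z h with z Fin.≟ u | z Fin.≟ v | z Fin.≟ w
  ... | yes p | _     | _     = inj₁ p
  ... | no _  | yes p | _     = inj₂ (inj₁ p)
  ... | no _  | no _  | yes p = inj₂ (inj₂ p)

  oneOf-false : ∀ {u v w z} → ¬ z ≡ u → ¬ z ≡ v → ¬ z ≡ w → oneOf u v w z ≡ false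
  oneOf-false a b c = ≢true⇒≡false λ h → case oneOf-elim _ h of λ
    { (inj₁ e) → a e ; (inj₂ (inj₁ e)) → b e ; (inj₂ (inj₂ e)) → c e }

  oneOf-fst : ∀ u v w → oneOf u v w u ≡ true
  oneOf-fst u v w rewrite dec-true (u Fin.≟ u) refl = refl

  oneOf-snd : ∀ u v w → oneOf u v w v ≡ true
  oneOf-snd u v w rewrite dec-true (v Fin.≟ v) refl = Bool.∨-zeroʳ (does (v Fin.≟ u))

  oneOf-thd : ∀ u v w → oneOf u v w w ≡ true
  oneOf-thd u v w rewrite dec-true (w Fin.≟ w) refl =
    trans (cong (does (w Fin.≟ u) ∨_) (Bool.∨-zeroʳ (does (w Fin.≟ v)))) (Bool.∨-zeroʳ (does (w Fin.≟ u)))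

module _ {n : ℕ} (G : Graph n) (on : Fin n → Bool) where

  open Partitions (vertices n)

  avoidsBoth : Dart n → Bool
  avoidsBoth (u , w) = adj G u w ∧ (not (on u) ∧ not (on w))

  -- The vertices with on u ≡ true stay as singleton classes.
  componentsAvoiding : Partition (Fin n)
  componentsAvoiding = generated (select (darts n) avoidsBoth)

  avoiding-edge : ∀ {u w} → adj G u w ≡ true → on u ≡ false → on w ≡ false → ⟨ componentsAvoiding ⟩ u ~ w
  avoiding-edge h hu hw = generated-∋ (∈-select⁺ (darts n) avoidsBoth (true∧ h (true∧ (cong not hu) (cong not hw))))

  avoiding-elim : (R : Fin n → Fin n → Set) → IsEquivalence R →
                  (∀ {u w} → adj G u w ≡ true → on u ≡ false → on w ≡ false → R u w) →
                  ∀ {u w} → ⟨ componentsAvoiding ⟩ u ~ w → R u w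
  avoiding-elim R R-eq h = generated-elim R R-eq _ λ {u} {w} m →
    let a , b = ∧-true (∈-select⁻ (darts n) avoidsBoth m)
        c , d = ∧-true b
    in h a (Bool.not-injective {on u} {false} c) (Bool.not-injective {on w} {false} d)

  avoiding-off : ∀ {u w} → ⟨ componentsAvoiding ⟩ u ~ w → on w ≡ false → on u ≡ false
  avoiding-off u~w hw = trans (avoiding-elim (λ u w → on u ≡ on w)
    (record { refl = refl ; sym = ≡.sym ; trans = trans }) (λ _ hu hw → trans hu (≡.sym hw)) u~w) hw

module Jordan {n : ℕ} (G : Graph n) (rot : Fin n → Fin n → Fin n) (isRot : IsRotation G rot)
              (euler : n + faces G rot ≡ edges G + 2 * #nontrivComps G + #isolated G) where

  open Finite (darts n)
  open Partitions (darts n)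
  open IsRotation isRot
  open Rotation G rot isRot
  open EdgeLists G rot isRot

  module _ {v p q : Fin n} (hvp : adj G v p ≡ true) (hvq : adj G v q ≡ true) (hpq : adj G p q ≡ true)
           (x≢q : ¬ rot v p ≡ q) (y≢p : ¬ rot v q ≡ p) where

    private
      x y : Fin n
      x = rot v p
      y = rot v q

      hvx : adj G v x ≡ true
      hvx = closed v p hvp
      hvy : adj G v y ≡ true
      hvy = closed v q hvq

      p≢q : ¬ p ≡ q
      p≢q = adj-≢ G hpq

      on : Fin n → Bool
      on = oneOf v p q

      on-v : on v ≡ true
      on-v = oneOf-fst v p q
      on-p : on p ≡ true
      on-p = oneOf-snd v p q
      on-q : on q ≡ true
      on-q = oneOf-thd v p q

    off-x : oneOf v p q (rot v p) ≡ false
    off-x = oneOf-false (adj-≢ G hvx ∘ ≡.sym)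
      (λ x≡p → arc-∌start G rot isRot hvp hvq p≢q (subst (Arc G rot isRot v p q) x≡p (arc-first G rot isRot))) x≢q
    off-y : oneOf v p q (rot v q) ≡ false
    off-y = oneOf-false (adj-≢ G hvy ∘ ≡.sym) y≢p
      (λ y≡q → arc-∌start G rot isRot hvq hvp (p≢q ∘ ≡.sym) (subst (Arc G rot isRot v q p) y≡q
            (arc-first G rot isRot)))

    private
      -- The triangle, the edge v x and all edges that avoid the triangle. If x and y were connected off the
      -- triangle, the edge v y would join two vertices of one component without lying in one face.
      S : Dart n → Bool
      S (u , w) = does (on u Bool.≟ on w) ∨ (does (u Fin.≟ v) ∧ does (w Fin.≟ x)) ∨
            (does (w Fin.≟ v) ∧ does (u Fin.≟ x))

      S-swap : ∀ d → S (swap d) ≡ S d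
      S-swap (u , w) = cong₂ _∨_ (agree (on u) (on w))
        (Bool.∨-comm (does (w Fin.≟ v) ∧ does (u Fin.≟ x)) (does (u Fin.≟ v) ∧ does (w Fin.≟ x)))
        where
        agree : ∀ a b → does (b Bool.≟ a) ≡ does (a Bool.≟ b)
        agree true  true  = refl
        agree true  false = refl
        agree false true  = refl
        agree false false = refl

      S-same : ∀ {u w} → on u ≡ on w → S (u , w) ≡ true
      S-same {u} {w} eq rewrite dec-true (on u Bool.≟ on w) eq = refl

      S-mixed : ∀ {u w} → on u ≡ false → on w ≡ true → S (u , w) ≡ true → u ≡ x × w ≡ v
      S-mixed {u} {w} off on-w h with ∨-true {does (on u Bool.≟ on w)} h
      ... | inj₁ same = case trans (≡.sym off) (trans (does⇒ (on u Bool.≟ on w) same) on-w) of λ ()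
      ... | inj₂ h′ with ∨-true {does (u Fin.≟ v) ∧ does (w Fin.≟ x)} h′
      ...   | inj₁ uv = case trans (≡.sym off) (trans (cong on (does⇒ (u Fin.≟ v) (proj₁ (∧-true uv)))) on-v) of λ ()
      ...   | inj₂ wv = does⇒ (u Fin.≟ x) (proj₂ (∧-true {a = does (w Fin.≟ v)} wv)) , does⇒ (w Fin.≟ v)
            (proj₁ (∧-true wv))

      open Sub S S-swap

      -- Closed under face tracing: the arc at each corner ends with the dart to the next corner.
      Side : Dart n → Set
      Side (w , s) = (w ≡ v × Arc G rot isRot v p q s) ⊎ (w ≡ q × Arc G rot isRot q v p s)
                   ⊎ (w ≡ p × Arc G rot isRot p q v s) ⊎ on w ≡ false

      off-side : ∀ {w s} → on w ≡ false → Side (w , s)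
      off-side = inj₂ ∘ inj₂ ∘ inj₂

      face-true : ∀ {w s} → adj G w s ≡ true → S (w , s) ≡ true → face subEdges (w , s) ≡ (s , rot s w)
      face-true h Sd = trans (face-S h Sd) (σ-adj (adj-swap G h))

      face-false : ∀ {w s} → adj G w s ≡ true → S (w , s) ≡ false → face subEdges (w , s) ≡ (w , rot w s)
      face-false h Sd = trans (face-¬S Sd) (σ-adj h)

      -- One argument for the corners `(v , p , q)`, `(q , v , p)` and `(p , q , v)`. A missing edge
      -- means a turn within the arc, which cannot run past `c` because the edge from `a` to `c` is
      -- present. A present edge leads to `c`, where the next arc starts, or off the triangle.
      corner : ∀ {a b c s} → adj G a b ≡ true → adj G a c ≡ true → ¬ b ≡ c → on a ≡ true → on c ≡ true →
               (∀ z → on z ≡ true → z ≡ a ⊎ z ≡ b ⊎ z ≡ c) →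
               (∀ {z} → Arc G rot isRot a b c z → Side (a , z)) → Side (c , rot c a) →
               adj G a s ≡ true → Arc G rot isRot a b c s → Side (face subEdges (a , s))
      corner {a} {b} {c} {s} hab hac b≢c on-a on-c elim here-side next-side h arc with S (a , s) in Sd
      ... | false = subst Side (≡.sym (face-false h Sd)) (here-side (arc-next G rot isRot arc
              λ { refl → case trans (≡.sym Sd) (S-same {a} {s} (trans on-a (≡.sym on-c))) of λ () }))
      ... | true = subst Side (≡.sym (face-true h Sd)) (turn refl)
        where
        turn : ∀ {o} → on s ≡ o → Side (s , rot s a)
        turn {false} off = off-side off
        turn {true} on-s with elim s on-s
        ... | inj₁ refl        = contradiction refl (adj-≢ G h)
        ... | inj₂ (inj₁ refl) = contradiction arc (arc-∌start G rot isRot hab hac b≢c)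
        ... | inj₂ (inj₂ refl) = next-side

      side-face : ∀ d → Side d → Side (face subEdges d)
      side-face (w , s) side with adj G w s in h
      ... | false = subst Side (≡.sym fixed) side
        where
        fixed : face subEdges (w , s) ≡ (w , s)
        fixed with S (w , s) in Sd
        ... | false = trans (face-¬S Sd) (σ-nonadj h)
        ... | true = trans (face-off (select (darts n) (λ d → canonical d ∧ S d))
                (λ m → case trans (≡.sym h) (member m) of λ ())
                (λ m → case trans (≡.sym (trans (sym G s w) h)) (member m) of λ ()))
                (σ-nonadj h)
          where
          member : ∀ {d} → d ∈ select (darts n) (λ d → canonical d ∧ S d) → Adj G d ≡ true
          member m = Adj-canonical (proj₁ (∧-true (∈-select⁻ (darts n) _ m)))
      side-face (w , s) (inj₁ (refl , arc)) | true =
        corner hvp hvq p≢q on-v on-q oneOf-elim (λ a → inj₁ (refl , a))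
          (inj₂ (inj₁ (refl , arc-first G rot isRot))) h arc
      side-face (w , s) (inj₂ (inj₁ (refl , arc))) | true =
        corner (adj-swap G hvq) (adj-swap G hpq) (adj-≢ G hvp) on-q on-p
          (λ z o → case oneOf-elim z o of λ { (inj₁ e) → inj₂ (inj₁ e) ; (inj₂ (inj₁ e)) → inj₂ (inj₂ e) ;
                (inj₂ (inj₂ e)) → inj₁ e })
          (λ a → inj₂ (inj₁ (refl , a))) (inj₂ (inj₂ (inj₁ (refl , arc-first G rot isRot)))) h arc
      side-face (w , s) (inj₂ (inj₂ (inj₁ (refl , arc)))) | true =
        corner hpq (adj-swap G hvp) (adj-≢ G hvq ∘ ≡.sym) on-p on-v
          (λ z o → case oneOf-elim z o of λ { (inj₁ e) → inj₂ (inj₂ e) ; (inj₂ (inj₁ e)) → inj₁ e ;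
                (inj₂ (inj₂ e)) → inj₂ (inj₁ e) })
          (λ a → inj₂ (inj₂ (inj₁ (refl , a)))) (inj₁ (refl , arc-first G rot isRot)) h arc
      side-face (w , s) (inj₂ (inj₂ (inj₂ off))) | true with S (w , s) in Sd
      ... | false = subst Side (≡.sym (face-false h Sd)) (off-side off)
      ... | true = subst Side (≡.sym (face-true h Sd)) (turn refl)
        where
        turn : ∀ {o} → on s ≡ o → Side (s , rot s w)
        turn {false} off-s = off-side off-s
        turn {true} on-s with S-mixed {w} {s} off on-s Sd
        -- The edge from `x` to `v` is the only entrance to the triangle. The turn at `v` after it
        -- stays in the arc from `p` to `q` because `x` is not yet `q`.
        ... | refl , refl = inj₁ (refl , arc-next G rot isRot (arc-first G rot isRot) x≢q)

      side-orbit : ∀ {d d′} → ⟨ cycles (face subEdges) ⟩ d ~ d′ → Side d → Side d′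
      side-orbit {d} d~d′ side with cycles⇒orbit (face-injective subEdges) d~d′
      ... | k , refl = go k
        where
        go : ∀ k → Side (iter (face subEdges) k d)
        go zero    = side
        go (suc k) = side-face _ (go k)

      S-vx : S (v , x) ≡ true
      S-vx rewrite dec-true (v Fin.≟ v) refl | dec-true (x Fin.≟ x) refl = Bool.∨-zeroʳ _

      S-vy : S (v , y) ≡ false
      S-vy rewrite on-v | off-y | dec-true (v Fin.≟ v) refl
        | dec-false (y Fin.≟ x) (λ y≡x → p≢q (rot-injective hvp hvq (≡.sym y≡x)))
        | dec-false (y Fin.≟ v) (adj-≢ G hvy ∘ ≡.sym) = refl

      -- Carries connectivity from vertices to darts: `(u , neighbour G u)` stands for `u`, since
      -- all darts at `u` form one cycle of `σ`.
      spokes : ∀ {u w} → ⟨ componentsAvoiding G on ⟩ u ~ w →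
               ⟨ component subEdges ⟩ (u , neighbour G u) ~ (w , neighbour G w)
      spokes = avoiding-elim G on
        (λ u w → ⟨ component subEdges ⟩ (u , neighbour G u) ~ (w , neighbour G w))
        (record { refl = refl ; sym = ≡.sym ; trans = trans })
        λ {u} {w} h hu hw → trans (around (neighbour-adj G h) h)
          (trans (component-S h (S-same {u} {w} (trans hu (≡.sym hw))))
            (around (adj-swap G h) (neighbour-adj G (adj-swap G h))))
        where
        around : ∀ {u w w′} → adj G u w ≡ true → adj G u w′ ≡ true → ⟨ component subEdges ⟩ (u , w) ~ (u , w′)
        around = σ-transitive (component subEdges) (component-σ subEdges)

    -- With `y = rot v q`, the dart `(y , v)` satisfies `Side` because `y` is off the triangle, but
    -- `(v , y)` does not: `y` comes just after the end `q` of the arc at `v`. As `Side` is closed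
    -- under face tracing, the two darts are on different faces, against `edge-in-face`.
    triangle-separates : ¬ ⟨ componentsAvoiding G (oneOf v p q) ⟩ rot v p ~ rot v q
    triangle-separates x~y = case side-orbit (≡.sym same-face) (off-side off-y) of λ
      { (inj₁ (_ , arc))            → arc-∌after G rot isRot hvp hvq p≢q arc
      ; (inj₂ (inj₁ (v≡q , _)))        → adj-≢ G hvq v≡q
      ; (inj₂ (inj₂ (inj₁ (v≡p , _)))) → adj-≢ G hvp v≡p
      ; (inj₂ (inj₂ (inj₂ off)))       → case trans (≡.sym on-v) off of λ () }
      where
      around : ∀ {u w w′} → adj G u w ≡ true → adj G u w′ ≡ true → ⟨ component subEdges ⟩ (u , w) ~ (u , w′)
      around = σ-transitive (component subEdges) (component-σ subEdges)
      connected-ends : ⟨ component subEdges ⟩ (v , y) ~ (y , v)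
      connected-ends = trans (around hvy hvx) (trans (component-S hvx S-vx)
        (trans (around (adj-swap G hvx) (neighbour-adj G (adj-swap G hvx)))
        (trans (spokes x~y) (around (neighbour-adj G (adj-swap G hvy)) (adj-swap G hvy)))))
      same-face : ⟨ cycles (face subEdges) ⟩ (v , y) ~ (y , v)
      same-face = edge-in-face euler S S-swap hvy S-vy connected-ends

-- A vertex whose adjacent neighbours are always consecutive

Consecutive : ∀ {n} → Graph n → (Fin n → Fin n → Fin n) → Fin n → Set
Consecutive G rot v = ∀ p q → adj G v p ≡ true → adj G v q ≡ true → adj G p q ≡ true →
                      rot v p ≡ q ⊎ rot v q ≡ p

module CliqueBoundary {n : ℕ} (G : Graph n) (rot : Fin n → Fin n → Fin n) (isRot : IsRotation G rot)
              (euler : n + faces G rot ≡ edges G + 2 * #nontrivComps G + #isolated G) where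

  open Finite (vertices n) using (#)
  open Partition using (rep)
  open IsRotation isRot

  Boundary : (Fin n → Bool) → Fin n → Set
  Boundary A b = A b ≡ false × ∃ λ s → A s ≡ true × adj G s b ≡ true

  HasCliqueBoundary : (Fin n → Bool) → Set
  HasCliqueBoundary A = ∀ {a b} → Boundary A a → Boundary A b → ¬ a ≡ b → adj G a b ≡ true

  module _ (A : Fin n → Bool) (clique : HasCliqueBoundary A) {v p q : Fin n} (Av : A v ≡ true)
           (hvp : adj G v p ≡ true) (hvq : adj G v q ≡ true) (hpq : adj G p q ≡ true) where

    private
      on : Fin n → Bool
      on = oneOf v p q
      K : Partition (Fin n)
      K = componentsAvoiding G on

    -- The new set is the part of `A` in the class of `w`; it loses `v`. A boundary vertex of it off
    -- the triangle would be in the class of `w` too, hence outside `A` and on the boundary of `A`,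
    -- which `apart` forbids. So the new boundary lies in the triangle, a clique.
    shrink : ∀ {w} → adj G v w ≡ true → on w ≡ false → (∀ {z} → Boundary A z → ¬ ⟨ K ⟩ z ~ w) →
             ∃ λ A′ → # A′ < # A × A′ w ≡ true × HasCliqueBoundary A′
    shrink {w} hvw off-w apart = A′ , smaller , true∧ Aw (dec-true (rep K w Fin.≟ rep K w) refl) , clique′
      where
      A′ : Fin n → Bool
      A′ u = A u ∧ does (rep K u Fin.≟ rep K w)
      Aw : A w ≡ true
      Aw with A w in eq
      ... | true  = refl
      -- Outside `A`, the neighbour `w` of `v` would itself be a boundary vertex in its own class.
      ... | false = contradiction refl (apart (eq , v , Av , hvw))
      A′v : A′ v ≡ false
      A′v = ≢true⇒≡false λ h → case trans (≡.sym (oneOf-fst v p q))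
        (avoiding-off G on (does⇒ (_ Fin.≟ _) (proj₂ (∧-true {a = A v} h))) off-w) of λ ()
      smaller : # A′ < # A
      smaller = begin
        suc (# A′)                                   ≡⟨ cong (_+ # A′) (Finite.#-singleton (vertices n) v) ⟨
        # (λ u → does (v Fin.≟ u)) + # A′            ≡⟨ sumF-+ (λ u → ⟦ does (v Fin.≟ u) ⟧) _ ⟨
        sumF (λ u → ⟦ does (v Fin.≟ u) ⟧ + ⟦ A′ u ⟧) ≤⟨ sumF-mono pointwise ⟩
        # A ∎
        where
        open ≤-Reasoning
        pointwise : ∀ u → ⟦ does (v Fin.≟ u) ⟧ + ⟦ A′ u ⟧ ≤ ⟦ A u ⟧
        pointwise u with v Fin.≟ u
        ... | yes refl = ≤-reflexive (trans (cong (suc ∘ ⟦_⟧) A′v) (cong ⟦_⟧ (≡.sym Av)))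
        ... | no _     = ⟦⟧-mono {A′ u} (proj₁ ∘ ∧-true)
      boundary-on : ∀ {a} → Boundary A′ a → on a ≡ true
      boundary-on {a} (A′a , s , A′s , hsa) with on a in off-a
      ... | true  = refl
      ... | false = contradiction a~w (apart (Aa , s , proj₁ (∧-true A′s) , hsa))
        where
        s~w : ⟨ K ⟩ s ~ w
        s~w = does⇒ (_ Fin.≟ _) (proj₂ (∧-true {a = A s} A′s))
        a~w : ⟨ K ⟩ a ~ w
        a~w = trans (≡.sym (avoiding-edge G on hsa (avoiding-off G on s~w off-w) off-a)) s~w
        Aa : A a ≡ false
        Aa = ≢true⇒≡false λ h → case trans (≡.sym A′a) (true∧ h (dec-true (_ Fin.≟ _) a~w)) of λ ()
      clique′ : HasCliqueBoundary A′
      clique′ {a} {b} ∂a ∂b a≢b with oneOf-elim a (boundary-on ∂a) | oneOf-elim b (boundary-on ∂b)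
      ... | inj₁ refl        | inj₁ refl        = contradiction refl a≢b
      ... | inj₁ refl        | inj₂ (inj₁ refl) = hvp
      ... | inj₁ refl        | inj₂ (inj₂ refl) = hvq
      ... | inj₂ (inj₁ refl) | inj₁ refl        = adj-swap G hvp
      ... | inj₂ (inj₁ refl) | inj₂ (inj₁ refl) = contradiction refl a≢b
      ... | inj₂ (inj₁ refl) | inj₂ (inj₂ refl) = hpq
      ... | inj₂ (inj₂ refl) | inj₁ refl        = adj-swap G hvq
      ... | inj₂ (inj₂ refl) | inj₂ (inj₁ refl) = adj-swap G hpq
      ... | inj₂ (inj₂ refl) | inj₂ (inj₂ refl) = contradiction refl a≢b

    -- The clique bounding A lies on one side of the triangle v p q, so A can be cut down to the other side.
    cut : ¬ rot v p ≡ q → ¬ rot v q ≡ p → ∃ λ A′ → # A′ < # A × (∃ λ w → A′ w ≡ true) × HasCliqueBoundary A′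
    cut x≢q y≢p with Fin.any? (λ z → boundary? z ×-dec (rep K z Fin.≟ rep K (rot v p)))
      where
      boundary? : ∀ z → Dec (Boundary A z)
      boundary? z = (A z Bool.≟ false) ×-dec Fin.any? (λ s → (A s Bool.≟ true) ×-dec (adj G s z Bool.≟ true))
    ... | no none =
      let A′ , less , A′w , clique′ = shrink (closed v p hvp) off-x (λ ∂z z~x → none (_ , ∂z , z~x))
      in A′ , less , (_ , A′w) , clique′
      where
      off-x : on (rot v p) ≡ false
      off-x = Jordan.off-x G rot isRot euler hvp hvq hpq x≢q y≢p
    ... | yes (z , ∂z , z~x) =
      let A′ , less , A′w , clique′ = shrink (closed v q hvq) off-y apart
      in A′ , less , (_ , A′w) , clique′
      where
      off-x : on (rot v p) ≡ false
      off-x = Jordan.off-x G rot isRot euler hvp hvq hpq x≢q y≢p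
      off-y : on (rot v q) ≡ false
      off-y = Jordan.off-y G rot isRot euler hvp hvq hpq x≢q y≢p
      apart : ∀ {z′} → Boundary A z′ → ¬ ⟨ K ⟩ z′ ~ rot v q
      apart {z′} ∂z′ z′~y = Jordan.triangle-separates G rot isRot euler hvp hvq hpq x≢q y≢p
        (trans (≡.sym z~x) (trans z~z′ z′~y))
        where
        z~z′ : ⟨ K ⟩ z ~ z′
        z~z′ with z Fin.≟ z′
        ... | yes refl = refl
        ... | no z≢z′  = avoiding-edge G on (clique ∂z ∂z′ z≢z′) (avoiding-off G on z~x off-x)
              (avoiding-off G on z′~y off-y)

  consecutive? : ∀ v → Consecutive G rot v ⊎
    ∃ λ p → ∃ λ q → adj G v p ≡ true × adj G v q ≡ true × adj G p q ≡ true × ¬ rot v p ≡ q × ¬ rot v q ≡ p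
  consecutive? v with Fin.any? (λ p → Fin.any? (λ q → (adj G v p Bool.≟ true) ×-dec (adj G v q Bool.≟ true)
                        ×-dec (adj G p q Bool.≟ true) ×-dec ¬? (rot v p Fin.≟ q) ×-dec ¬? (rot v q Fin.≟ p)))
  ... | yes chord = inj₂ chord
  ... | no none = inj₁ consecutive
    where
    consecutive : Consecutive G rot v
    consecutive p q hp hq hpq with rot v p Fin.≟ q | rot v q Fin.≟ p
    ... | yes eq | _      = inj₁ eq
    ... | no _   | yes eq = inj₂ eq
    ... | no ne  | no ne′ = contradiction (p , q , hp , hq , hpq , ne , ne′) none

  descend : ∀ m (A : Fin n → Bool) → # A < m → ∃ (λ v → A v ≡ true) → HasCliqueBoundary A → ∃ (Consecutive G rot)
  descend (suc m) A (s≤s A≤m) (v , Av) clique with consecutive? v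
  ... | inj₁ consecutive = v , consecutive
  ... | inj₂ (p , q , hvp , hvq , hpq , x≢q , y≢p) =
    let A′ , less , nonempty , clique′ = cut A clique Av hvp hvq hpq x≢q y≢p
    in descend m A′ (≤-trans less A≤m) nonempty clique′

  consecutive-vertex : Fin n → ∃ (Consecutive G rot)
  -- The descent starts from the set of all vertices, whose boundary is empty and so trivially a
  -- clique.
  consecutive-vertex v = descend (suc (# (λ _ → true))) (λ _ → true) ≤-refl (v , refl) (λ { (() , _) })

-- Corners and faces

if-≤ : ∀ {b} {m k : ℕ} → m ≤ k → (if b then m else 0) ≤ k
if-≤ {true}  h = h
if-≤ {false} h = z≤n

module _ {n : ℕ} (G : Graph n) where

  open Finite (darts n) using (#)

  ∑degree : sumF (degree G) ≡ 2 * edges G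
  ∑degree = begin
    sumF (degree G)
      ≡⟨ sumF-cong (λ u → trans (count≡sumF (adj G u)) (sumF-cong (split u))) ⟩
    sumF (λ u → sumF (λ v → c u v + c v u))
      ≡⟨ trans (sumF-cong (λ u → sumF-+ (c u) (λ v → c v u))) (sumF-+ (λ u → sumF (c u)) (λ u → sumF (λ v → c v u))) ⟩
    sumF (λ u → sumF (c u)) + sumF (λ u → sumF (λ v → c v u))
      ≡⟨ cong₂ _+_ E (trans (≡.sym (sumF-swap c)) (trans E (≡.sym (+-identityʳ _)))) ⟩
    2 * edges G ∎
    where
    open ≡-Reasoning
    c : Fin n → Fin n → ℕ
    c u v = ⟦ adj G u v ∧ (toℕ u <ᵇ toℕ v) ⟧
    E : sumF (λ u → sumF (c u)) ≡ edges G
    E = sumF-cong (λ u → ≡.sym (count≡sumF (λ v → adj G u v ∧ (toℕ u <ᵇ toℕ v))))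
    split : ∀ u v → ⟦ adj G u v ⟧ ≡ c u v + c v u
    split u v rewrite sym G v u with adj G u v in h
    ... | false = refl
    ... | true with <-cmp (toℕ u) (toℕ v)
    ...   | tri< lt _ ¬gt rewrite <ᵇ-true lt | ≢true⇒≡false (¬gt ∘ <ᵇ-true⁻ {toℕ v} {toℕ u}) = refl
    ...   | tri≈ _ eq _ = contradiction (Fin.toℕ-injective eq) (adj-≢ G h)
    ...   | tri> ¬lt _ gt rewrite <ᵇ-true gt | ≢true⇒≡false (¬lt ∘ <ᵇ-true⁻ {toℕ u} {toℕ v}) = refl

  #Adj : # (Adj G) ≡ 2 * edges G
  #Adj = trans (∑-darts (⟦_⟧ ∘ Adj G)) (trans (sumF-cong (λ u → ≡.sym (count≡sumF (adj G u)))) ∑degree)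

  chord : Fin n → Fin n → Fin n → Bool
  chord v u w = adj G v u ∧ adj G v w ∧ adj G u w ∧ (toℕ u <ᵇ toℕ w)

  e≡∑chord : ∀ v → e G v ≡ sumF (λ u → sumF (λ w → ⟦ chord v u w ⟧))
  e≡∑chord v = sumF-cong (λ u → count≡sumF (chord v u))

  2e : ∀ v → 2 * e G v ≡ sumF (λ u → sumF (λ w → ⟦ adj G v u ∧ adj G v w ∧ adj G u w ⟧))
  2e v = ≡.sym (begin
    sumF (λ u → sumF (λ w → ⟦ adj G v u ∧ adj G v w ∧ adj G u w ⟧))
      ≡⟨ sumF-cong (λ u → sumF-cong (split u)) ⟩
    sumF (λ u → sumF (λ w → c u w + c w u))
      ≡⟨ trans (sumF-cong (λ u → sumF-+ (c u) (λ w → c w u))) (sumF-+ (λ u → sumF (c u)) (λ u → sumF (λ w → c w u))) ⟩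
    sumF (λ u → sumF (c u)) + sumF (λ u → sumF (λ w → c w u))
      ≡⟨ cong₂ _+_ (≡.sym (e≡∑chord v)) (trans (≡.sym (sumF-swap c))
            (trans (≡.sym (e≡∑chord v)) (≡.sym (+-identityʳ _)))) ⟩
    2 * e G v ∎)
    where
    open ≡-Reasoning
    c : Fin n → Fin n → ℕ
    c u w = ⟦ chord v u w ⟧
    split : ∀ u w → ⟦ adj G v u ∧ adj G v w ∧ adj G u w ⟧ ≡ c u w + c w u
    split u w rewrite sym G w u with adj G v u | adj G v w | adj G u w in h
    ... | false | false | _     = refl
    ... | false | true  | _     = refl
    ... | true  | false | _     = refl
    ... | true  | true  | false = refl
    ... | true  | true  | true with <-cmp (toℕ u) (toℕ w)
    ...   | tri< lt _ ¬gt rewrite <ᵇ-true lt | ≢true⇒≡false (¬gt ∘ <ᵇ-true⁻ {toℕ w} {toℕ u}) = refl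
    ...   | tri≈ _ eq _ = contradiction (Fin.toℕ-injective eq) (adj-≢ G h)
    ...   | tri> ¬lt _ gt rewrite <ᵇ-true gt | ≢true⇒≡false (¬lt ∘ <ᵇ-true⁻ {toℕ u} {toℕ w}) = refl

  -- Ordered pairs of neighbours of v: adjacent ones, equal ones, and the remaining ones counted by extra.
  2e+degree≤degree² : ∀ v (extra : Fin n → Fin n → Bool) →
    (∀ u w → extra u w ≡ true → adj G v u ≡ true × adj G v w ≡ true × adj G u w ≡ false × ¬ u ≡ w) →
    2 * e G v + degree G v + sumF (λ u → sumF (λ w → ⟦ extra u w ⟧)) ≤ degree G v * degree G v
  2e+degree≤degree² v extra h = begin
    2 * e G v + degree G v + sumF (λ u → sumF (x u))
      ≡⟨ cong (_+ sumF (λ u → sumF (x u))) (cong₂ _+_ (2e v) (trans (count≡sumF (adj G v))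
            (sumF-cong (λ u → ≡.sym (sumF-δ u (λ w → ⟦ adj G v w ⟧)))))) ⟩
    sumF (λ u → sumF (t u)) + sumF (λ u → sumF (δ u)) + sumF (λ u → sumF (x u))
      ≡⟨ cong (_+ sumF (λ u → sumF (x u))) (≡.sym (sum² t δ)) ⟩
    sumF (λ u → sumF (λ w → t u w + δ u w)) + sumF (λ u → sumF (x u))
      ≡⟨ ≡.sym (sum² (λ u w → t u w + δ u w) x) ⟩
    sumF (λ u → sumF (λ w → t u w + δ u w + x u w))
      ≤⟨ sumF-mono (λ u → sumF-mono (pointwise u)) ⟩
    sumF (λ u → sumF (λ w → ⟦ adj G v u ⟧ * ⟦ adj G v w ⟧))
      ≡⟨ sumF-cong (λ u → trans (sumF-*ˡ ⟦ adj G v u ⟧ (⟦_⟧ ∘ adj G v))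
           (trans (cong (⟦ adj G v u ⟧ *_) (≡.sym (count≡sumF (adj G v)))) (*-comm ⟦ adj G v u ⟧ (degree G v)))) ⟩
    sumF (λ u → degree G v * ⟦ adj G v u ⟧)
      ≡⟨ trans (sumF-*ˡ (degree G v) (⟦_⟧ ∘ adj G v)) (cong (degree G v *_) (≡.sym (count≡sumF (adj G v)))) ⟩
    degree G v * degree G v ∎
    where
    open ≤-Reasoning
    t δ x : Fin n → Fin n → ℕ
    t u w = ⟦ adj G v u ∧ adj G v w ∧ adj G u w ⟧
    δ u w = if does (u Fin.≟ w) then ⟦ adj G v w ⟧ else 0
    x u w = ⟦ extra u w ⟧
    sum² : (f g : Fin n → Fin n → ℕ) → sumF (λ u → sumF (λ w → f u w + g u w)) ≡ sumF (λ u → sumF (f u)) + sumF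
          (λ u → sumF (g u))
    sum² f g = trans (sumF-cong (λ u → sumF-+ (f u) (g u))) (sumF-+ (λ u → sumF (f u)) (λ u → sumF (g u)))
    pointwise : ∀ u w → t u w + δ u w + x u w ≤ ⟦ adj G v u ⟧ * ⟦ adj G v w ⟧
    pointwise u w with extra u w in eq
    ... | true with h u w eq
    ...   | hu , hw , na , u≢w rewrite hu | hw | na | dec-false (u Fin.≟ w) u≢w = ≤-refl
    pointwise u w | false with u Fin.≟ w
    ... | yes refl rewrite irrefl G u with adj G v u
    ...   | true  = ≤-refl
    ...   | false = ≤-refl
    pointwise u w | false | no _ with adj G v u | adj G v w | adj G u w
    ...   | true  | true  | true  = ≤-refl
    ...   | true  | true  | false = z≤n
    ...   | true  | false | _     = z≤n
    ...   | false | _     | _     = z≤n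

module Corners {n : ℕ} (G : Graph n) (rot : Fin n → Fin n → Fin n) (isRot : IsRotation G rot) where

  open IsRotation isRot
  open Rotation G rot isRot using (rot-injective)

  -- By `cyclic` every neighbour is an iterate of `p`, and exponents matter only modulo `suc k`.
  degree≤period : ∀ {v p} k → adj G v p ≡ true → iter (rot v) (suc k) p ≡ p → degree G v ≤ suc k
  degree≤period {v} {p} k hp eq = begin
    degree G v ≡⟨ count≡sumF (adj G v) ⟩
    sumF (λ w → ⟦ adj G v w ⟧) ≤⟨ sumF-mono visited ⟩
    sumF (λ w → sumF (λ j → visit w j)) ≡⟨ sumF-swap visit ⟩
    sumF (λ j → sumF (λ w → visit w j)) ≡⟨ sumF-cong {suc k} (λ j → sumF-δ (iter (rot v) (toℕ j) p) (λ _ → 1)) ⟩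
    sumF {suc k} (λ _ → 1) ≡⟨ trans (sumF-const (suc k) 1) (*-identityʳ (suc k)) ⟩
    suc k ∎
    where
    open ≤-Reasoning
    visit : Fin n → Fin (suc k) → ℕ
    visit w j = if does (iter (rot v) (toℕ j) p Fin.≟ w) then 1 else 0
    visited : ∀ w → ⟦ adj G v w ⟧ ≤ sumF (visit w)
    visited w with adj G v w in hw
    ... | false = z≤n
    ... | true with cyclic v p w hp hw
    ...   | m , refl = ∃⇒1≤sumF (visit w) (fromℕ< (m%n<n m (suc k)))
              (≤-reflexive (≡.sym (cong (if_then 1 else 0) (dec-true (_ Fin.≟ w) (trans
                (cong (λ j → iter (rot v) j p) (Fin.toℕ-fromℕ< (m%n<n m (suc k)))) (≡.sym reduce))))))
      where
      reduce : iter (rot v) m p ≡ iter (rot v) (m ℕ.% suc k) p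
      reduce = trans (cong (λ j → iter (rot v) j p) (m≡m%n+[m/n]*n m (suc k)))
        (trans (iter-+ (rot v) (m ℕ.% suc k) _ p) (cong (iter (rot v) (m ℕ.% suc k))
              (iter-* (rot v) (suc k) eq (m ℕ./ suc k))))

  -- Counts adjacent consecutive neighbours of `v`. Every triangular face at `v` yields one, and so
  -- may a triangle that bounds no face: an upper bound for the triangular corners.
  corners : Fin n → ℕ
  corners v = sumF (λ u → ⟦ adj G v u ∧ adj G u (rot v u) ⟧)

  -- The value is 2 exactly when the chord joins two neighbours that follow each other, that is,
  -- when they are the only neighbours of `v`. This is the source of the factor in `corners≤2e`.
  consecutiveChord : Fin n → Fin n → Fin n → ℕ
  consecutiveChord v u w = (if does (rot v u Fin.≟ w) then ⟦ chord G v u w ⟧ else 0)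
                         + (if does (rot v w Fin.≟ u) then ⟦ chord G v u w ⟧ else 0)

  corners≡∑consecutive : ∀ v → corners v ≡ sumF (λ u → sumF (consecutiveChord v u))
  corners≡∑consecutive v = begin
    corners v
      ≡⟨ sumF-cong split ⟩
    sumF (λ u → h u (rot v u) + h (rot v u) u)
      ≡⟨ sumF-+ (λ u → h u (rot v u)) (λ u → h (rot v u) u) ⟩
    sumF (λ u → h u (rot v u)) + sumF (λ u → h (rot v u) u)
      ≡⟨ cong₂ _+_ (sumF-cong (λ u → ≡.sym (sumF-δ (rot v u) (h u))))
                   (trans (sumF-cong (λ u → ≡.sym (sumF-δ (rot v u) (λ w → h w u))))
                     (sumF-swap (λ u w → if does (rot v u Fin.≟ w) then h w u else 0))) ⟩
    sumF (λ u → sumF (λ w → if does (rot v u Fin.≟ w) then h u w else 0))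
      + sumF (λ u → sumF (λ w → if does (rot v w Fin.≟ u) then h u w else 0))
      ≡⟨ sumF-+ (λ u → sumF (λ w → if does (rot v u Fin.≟ w) then h u w else 0)) _ ⟨
    sumF (λ u → sumF (λ w → if does (rot v u Fin.≟ w) then h u w else 0)
              + sumF (λ w → if does (rot v w Fin.≟ u) then h u w else 0))
      ≡⟨ sumF-cong (λ u → sumF-+ (λ w → if does (rot v u Fin.≟ w) then h u w else 0) _) ⟨
    sumF (λ u → sumF (consecutiveChord v u)) ∎
    where
    open ≡-Reasoning
    h : Fin n → Fin n → ℕ
    h u w = ⟦ chord G v u w ⟧
    split : ∀ u → ⟦ adj G v u ∧ adj G u (rot v u) ⟧ ≡ h u (rot v u) + h (rot v u) u
    split u with adj G v u in hu
    ... | false with adj G v (rot v u)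
    ...   | true  = refl
    ...   | false = refl
    split u | true rewrite closed v u hu | sym G (rot v u) u with adj G u (rot v u) in hw
    ... | false = refl
    ... | true with <-cmp (toℕ u) (toℕ (rot v u))
    ...   | tri< lt _ ¬gt rewrite <ᵇ-true lt | ≢true⇒≡false (¬gt ∘ <ᵇ-true⁻ {toℕ (rot v u)} {toℕ u}) = refl
    ...   | tri≈ _ eq _ = contradiction (Fin.toℕ-injective eq) (adj-≢ G hw)
    ...   | tri> ¬lt _ gt rewrite <ᵇ-true gt | ≢true⇒≡false (¬lt ∘ <ᵇ-true⁻ {toℕ u} {toℕ (rot v u)}) = refl

  corners≤degree : ∀ v → corners v ≤ degree G v
  corners≤degree v = ≤-trans (sumF-mono (λ u → ⟦⟧-mono {adj G v u ∧ adj G u (rot v u)} (proj₁ ∘ ∧-true)))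
                             (≤-reflexive (≡.sym (count≡sumF (adj G v))))

  corners≤2e : ∀ v → corners v ≤ 2 * e G v
  corners≤2e v = begin
    corners v ≡⟨ corners≡∑consecutive v ⟩
    sumF (λ u → sumF (consecutiveChord v u)) ≤⟨ sumF-mono (λ u → sumF-mono (λ w →
        +-mono-≤ (if-≤ {does (rot v u Fin.≟ w)} ≤-refl) (≤-trans (if-≤ {does (rot v w Fin.≟ u)} ≤-refl)
              (≤-reflexive (≡.sym (+-identityʳ _)))))) ⟩
    sumF (λ u → sumF (λ w → 2 * ⟦ chord G v u w ⟧)) ≡⟨ sumF-cong (λ u → sumF-*ˡ 2 (λ w → ⟦ chord G v u w ⟧)) ⟩
    sumF (λ u → 2 * sumF (λ w → ⟦ chord G v u w ⟧)) ≡⟨ sumF-*ˡ 2 (λ u → sumF (λ w → ⟦ chord G v u w ⟧)) ⟩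
    2 * sumF (λ u → sumF (λ w → ⟦ chord G v u w ⟧)) ≡⟨ cong (2 *_) (e≡∑chord G v) ⟨
    2 * e G v ∎
    where open ≤-Reasoning

  corners≤e : ∀ v → (∀ u → adj G v u ≡ true → ¬ rot v (rot v u) ≡ u) → corners v ≤ e G v
  corners≤e v long = begin
    corners v ≡⟨ corners≡∑consecutive v ⟩
    sumF (λ u → sumF (consecutiveChord v u)) ≤⟨ sumF-mono (λ u → sumF-mono (pointwise u)) ⟩
    sumF (λ u → sumF (λ w → ⟦ chord G v u w ⟧)) ≡⟨ e≡∑chord G v ⟨
    e G v ∎
    where
    open ≤-Reasoning
    pointwise : ∀ u w → consecutiveChord v u w ≤ ⟦ chord G v u w ⟧
    pointwise u w with chord G v u w in c
    ... | false = +-mono-≤ (if-≤ {does (rot v u Fin.≟ w)} ≤-refl) (if-≤ {does (rot v w Fin.≟ u)} ≤-refl)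
    ... | true with rot v u Fin.≟ w | rot v w Fin.≟ u
    ...   | no _     | no _  = z≤n
    ...   | no _     | yes _ = ≤-refl
    ...   | yes _    | no _  = ≤-refl
    ...   | yes refl | yes q = contradiction q (long u (proj₁ (∧-true c)))

  -- A chord gives two corners only if its ends follow each other around `v`. Then `v` has degree at
  -- most two and at most two corners; in all other cases corners inject into chords.
  corners≤max : ∀ v m → 2 ≤ m → e G v ≤ m → corners v ≤ m
  corners≤max v m 2≤m e≤m with Fin.any? (λ u → (adj G v u Bool.≟ true) ×-dec (rot v (rot v u) Fin.≟ u))
  ... | yes (u , hu , eq) = ≤-trans (corners≤degree v) (≤-trans (degree≤period 1 hu eq) 2≤m)
  ... | no none = ≤-trans (corners≤e v (λ u hu eq → none (u , hu , eq))) e≤m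

  -- Each chord now occupies at least one corner, and there are no more corners than turns around
  -- `v`.
  e≤degree : ∀ v → Consecutive G rot v → e G v ≤ degree G v
  e≤degree v consecutive = begin
    e G v ≡⟨ e≡∑chord G v ⟩
    sumF (λ u → sumF (λ w → ⟦ chord G v u w ⟧)) ≤⟨ sumF-mono (λ u → sumF-mono (pointwise u)) ⟩
    sumF (λ u → sumF (consecutiveChord v u)) ≡⟨ corners≡∑consecutive v ⟨
    corners v ≤⟨ corners≤degree v ⟩
    degree G v ∎
    where
    open ≤-Reasoning
    pointwise : ∀ u w → ⟦ chord G v u w ⟧ ≤ consecutiveChord v u w
    pointwise u w with chord G v u w in c
    ... | false = z≤n
    ... | true with ∧-true c
    ...   | hu , c′ with ∧-true c′
    ...     | hw , c″ with consecutive u w hu hw (proj₁ (∧-true c″))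
    ...       | inj₁ eq rewrite dec-true (rot v u Fin.≟ w) eq = s≤s z≤n
    ...       | inj₂ eq rewrite dec-true (rot v w Fin.≟ u) eq = m≤n+m 1 (if does (rot v u Fin.≟ w) then 1 else 0)

  module _ (euler : n + faces G rot ≡ edges G + 2 * #nontrivComps G + #isolated G) where

    -- With fewer than five neighbours, e v = 6 forces a K₄ on them; opposite pairs then cross.
    5≤degree : ∀ {v} → e G v ≡ 6 → 5 ≤ degree G v
    5≤degree {v} e≡6 = ≮⇒≥ λ d<5 → impossible (≤-pred d<5)
      where
      d = degree G v
      bound : ∀ extra → _ → 12 + d + sumF (λ u → sumF (λ w → ⟦ extra u w ⟧)) ≤ d * d
      bound extra h = subst (λ k → 2 * k + d + sumF (λ u → sumF (λ w → ⟦ extra u w ⟧)) ≤ d * d) e≡6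
            (2e+degree≤degree² G v extra h)
      4≤d : 12 + d ≤ d * d → 4 ≤ d
      4≤d = small d
        where
        small : ∀ d → 12 + d ≤ d * d → 4 ≤ d
        small 0 ()
        small 1 (s≤s ())
        small 2 (s≤s (s≤s (s≤s (s≤s ()))))
        small 3 (s≤s (s≤s (s≤s (s≤s (s≤s (s≤s (s≤s (s≤s (s≤s ())))))))))
        small (suc (suc (suc (suc d)))) _ = s≤s (s≤s (s≤s (s≤s z≤n)))
      d²≤12+d : d ≤ 4 → d * d ≤ 12 + d
      d²≤12+d d≤4 = small d d≤4
        where
        small : ∀ d → d ≤ 4 → d * d ≤ 12 + d
        small 0 _ = z≤n
        small 1 _ = ≤ᵇ⇒≤ 1 13 tt
        small 2 _ = ≤ᵇ⇒≤ 4 14 tt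
        small 3 _ = ≤ᵇ⇒≤ 9 15 tt
        small 4 _ = ≤ᵇ⇒≤ 16 16 tt
        small (suc (suc (suc (suc (suc _))))) (s≤s (s≤s (s≤s (s≤s ()))))
      impossible : d ≤ 4 → ⊥
      -- The triangle `v p p₂` would have to separate `p₁` from `p₃`, yet these two are adjacent.
      impossible d≤4 = triangle-separates hp hp₂ (complete hp hp₂ (p₂≢p ∘ ≡.sym)) p₁≢p₂ p₃≢p
        (avoiding-edge G (oneOf v p p₂) (complete hp₁ hp₃ p₁≢p₃)
          (off-x hp hp₂ (complete hp hp₂ (p₂≢p ∘ ≡.sym)) p₁≢p₂ p₃≢p)
          (off-y hp hp₂ (complete hp hp₂ (p₂≢p ∘ ≡.sym)) p₁≢p₂ p₃≢p))
        where
        open Jordan G rot isRot euler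
        complete : ∀ {a b} → adj G v a ≡ true → adj G v b ≡ true → ¬ a ≡ b → adj G a b ≡ true
        complete {a} {b} ha hb a≢b with adj G a b in hab
        ... | true  = refl
        -- One nonadjacent pair of neighbours, taken as `extra`, makes `12 + d` strictly less than
        -- `d * d`, which is impossible for `d ≤ 4`.
        ... | false = contradiction (d²≤12+d d≤4) (<⇒≱ (≤-trans (≤-trans (≤-reflexive (+-comm 1 (12 + d)))
              (+-monoʳ-≤ (12 + d) (∃⇒1≤sumF _ a (∃⇒1≤sumF _ b (≤-reflexive (≡.sym (cong ⟦_⟧ extra-ab)))))))
              (bound extra extra-ok)))
          where
          extra : Fin n → Fin n → Bool
          extra u w = does (u Fin.≟ a) ∧ does (w Fin.≟ b)
          extra-ab : extra a b ≡ true
          extra-ab = true∧ (dec-true (a Fin.≟ a) refl) (dec-true (b Fin.≟ b) refl)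
          extra-ok : ∀ u w → extra u w ≡ true → adj G v u ≡ true × adj G v w ≡ true × adj G u w ≡ false × ¬ u ≡ w
          extra-ok u w h with does⇒ (u Fin.≟ a) (proj₁ (∧-true h)) | does⇒ (w Fin.≟ b)
                (proj₂ (∧-true {a = does (u Fin.≟ a)} h))
          ... | refl | refl = ha , hb , hab , a≢b
        4≤degree : 4 ≤ d
        4≤degree = 4≤d (≤-trans (m≤m+n (12 + d) _) (bound (λ _ _ → false) (λ _ _ ())))
        some : ∃ λ p → 1 ≤ ⟦ adj G v p ⟧
        some = 1≤sumF⇒∃ (⟦_⟧ ∘ adj G v) (≤-trans (s≤s z≤n) (≤-trans 4≤degree (≤-reflexive (count≡sumF (adj G v)))))
        p = proj₁ some
        hp : adj G v p ≡ true
        hp = ⟦⟧-true (proj₂ some)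
        p₁ = rot v p
        p₂ = rot v p₁
        p₃ = rot v p₂
        hp₁ : adj G v p₁ ≡ true
        hp₁ = closed v p hp
        hp₂ : adj G v p₂ ≡ true
        hp₂ = closed v p₁ hp₁
        hp₃ : adj G v p₃ ≡ true
        hp₃ = closed v p₂ hp₂
        aperiodic : ∀ k → suc k < 4 → ¬ iter (rot v) (suc k) p ≡ p
        aperiodic k k<4 eq = <⇒≱ (≤-trans k<4 4≤degree) (degree≤period k hp eq)
        p₂≢p : ¬ p₂ ≡ p
        p₂≢p = aperiodic 1 (s≤s (s≤s (s≤s z≤n)))
        p₃≢p : ¬ p₃ ≡ p
        p₃≢p = aperiodic 2 ≤-refl
        p₁≢p₂ : ¬ p₁ ≡ p₂
        p₁≢p₂ eq = aperiodic 0 (s≤s (s≤s z≤n)) (≡.sym (rot-injective hp hp₁ eq))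
        p₁≢p₃ : ¬ p₁ ≡ p₃
        p₁≢p₃ eq = p₂≢p (≡.sym (rot-injective hp hp₂ eq))

-- Bounding the number of faces by their lengths

module FaceCount {n : ℕ} (G : Graph n) (rot : Fin n → Fin n → Fin n) (isRot : IsRotation G rot) where

  open Finite (darts n)
  open IsRotation isRot
  open Rotation G rot isRot
  open Corners G rot isRot

  α : Dart n → Dart n
  α d = if Adj G d then swap d else d

  α-involutive : ∀ d → α (α d) ≡ d
  α-involutive (u , v) with adj G u v in h
  ... | true  rewrite adj-swap G h = refl
  ... | false rewrite h = refl

  φ : Dart n → Dart n
  φ = σ ∘ α

  φ-injective : Injective _≡_ _≡_ φ
  φ-injective {c} {d} eq = trans (≡.sym (α-involutive c)) (trans (cong α (σ-injective eq)) (α-involutive d))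

  φ-adj : ∀ d → Adj G d ≡ true → φ d ≡ facePerm G rot d
  φ-adj (u , v) h rewrite h = σ-adj (adj-swap G h)

  Adj-φ : ∀ d → Adj G (φ d) ≡ Adj G d
  Adj-φ d@(u , v) = trans (Adj-σ (α d)) Adj-α
    where
    Adj-α : Adj G (α d) ≡ Adj G d
    Adj-α with adj G u v in h
    ... | true  = adj-swap G h
    ... | false = h

  Adj-iter : ∀ k d → Adj G (iter φ k d) ≡ Adj G d
  Adj-iter zero    d = refl
  Adj-iter (suc k) d = trans (Adj-φ (iter φ k d)) (Adj-iter k d)

  q : Dart n → Bool
  q = uncurry (faceRep G rot)

  #q : # q ≡ faces G rot
  #q = trans (∑-darts (⟦_⟧ ∘ q)) (sumF-cong (λ u → ≡.sym (count≡sumF (faceRep G rot u))))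

  #≤#∘ : ∀ {f : Dart n → Dart n} → Injective _≡_ _≡_ f → ∀ p → # p ≤ # (p ∘ f)
  #≤#∘ {f} inj p = #-injection p (p ∘ f) back
    (λ d pd → trans (cong p (f-back d)) pd)
    (λ c d _ _ eq → trans (≡.sym (f-back c)) (trans (cong f eq) (f-back d)))
    where
    back : Dart n → Dart n
    back d = iter f (proj₁ (periodic inj d)) d
    f-back : ∀ d → f (back d) ≡ d
    f-back d = proj₂ (proj₂ (periodic inj d))

  fixed : ℕ → Dart n → Bool
  fixed k d = Adj G d ∧ does (iter φ k d ≟ d)

  -- An integral substitute for giving each dart the weight 1/L, where L is the length of its face.
  -- Each iterate of `φ` permutes the darts, so every face representative is seen from `N` windows.
  window : ℕ → Dart n → ℕ
  window N d = sumF {N} (λ k → ⟦ q (iter φ (toℕ k) d) ⟧)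

  -- Cut the window into `m` blocks of length `L`. The darts within a block are distinct, and an
  -- orbit has only one representative, so a block contains it at most once.
  window≤ : ∀ {N} m L → N ≡ m * L → ∀ d → (∀ k → 0 < k → k < L → ¬ iter φ k d ≡ d) → window N d ≤ m
  window≤ m L refl d aperiodic = begin
    window (m * L) d
      ≡⟨ sumF-combine m L (λ k → ⟦ q (iter φ (toℕ k) d) ⟧) ⟩
    sumF (λ (i : Fin m) → sumF (λ (j : Fin L) → ⟦ q (iter φ (toℕ (combine i j)) d) ⟧))
      ≤⟨ sumF-mono (λ i → sumF-≤1 (λ j → q (iter φ (toℕ (combine {m} {L} i j)) d)) (once i)) ⟩
    sumF {m} (λ _ → 1)
      ≡⟨ trans (sumF-const m 1) (*-identityʳ m) ⟩
    m ∎
    where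
    open ≤-Reasoning
    distinct : ∀ j k → j < k → k < L → ¬ iter φ j d ≡ iter φ k d
    distinct j k j<k k<L eq with m≤n⇒∃[o]m+o≡n j<k
    ... | o , refl = aperiodic (suc o) (s≤s z≤n) (≤-trans (s≤s (s≤s (m≤n+m o j))) k<L)
      (≡.sym (iter-injective φ φ-injective j (trans eq
        (trans (cong (λ i → iter φ i d) (≡.sym (+-suc j o))) (iter-+ φ j (suc o) d)))))
    split : ∀ (i : Fin m) (j : Fin L) → iter φ (toℕ (combine i j)) d ≡ iter φ (L * toℕ i) (iter φ (toℕ j) d)
    split i j = trans (cong (λ k → iter φ k d) (Fin.toℕ-combine i j)) (iter-+ φ (L * toℕ i) (toℕ j) d)
    shared : ∀ (i : Fin m) (j k : Fin L) → q (iter φ (toℕ (combine i j)) d) ≡ true →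
             q (iter φ (toℕ (combine i k)) d) ≡ true → iter φ (toℕ j) d ≡ iter φ (toℕ k) d
    shared i j k qj qk = iter-injective φ φ-injective (L * toℕ i) (trans (≡.sym (split i j))
      (trans (faceRep-unique φ-injective φ-adj qj qk
        (IsEquivalence.trans (orbit-isEquivalence φ-injective) {j = d}
          (orbit-sym φ-injective (toℕ (combine i j) , refl)) (toℕ (combine i k) , refl)))
      (split i k)))
    once : ∀ (i : Fin m) (j k : Fin L) → q (iter φ (toℕ (combine i j)) d) ≡ true →
           q (iter φ (toℕ (combine i k)) d) ≡ true → j ≡ k
    once i j k qj qk with <-cmp (toℕ j) (toℕ k)
    ... | tri< j<k _ _ = contradiction (shared i j k qj qk) (distinct (toℕ j) (toℕ k) j<k (Fin.toℕ<n k))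
    ... | tri≈ _ eq _ = Fin.toℕ-injective eq
    ... | tri> _ _ k<j = contradiction (≡.sym (shared i j k qj qk)) (distinct (toℕ k) (toℕ j) k<j (Fin.toℕ<n j))


  φ-moves : ∀ {d} → Adj G d ≡ true → ¬ φ d ≡ d
  φ-moves {u , v} h eq = adj-≢ G h (≡.sym (cong proj₁ (trans (≡.sym (φ-adj (u , v) h)) eq)))

  -- Twelve consecutive darts of a face of length L contain its representative 12 / L times if L ≤ 4,
  -- and at most 3 times otherwise.
  twelve : ∀ d → window 12 d ≤ 3 * ⟦ Adj G d ⟧ + (⟦ fixed 3 d ⟧ + 3 * ⟦ fixed 2 d ⟧)
  twelve d = cases (Adj G d) (does (iter φ 3 d ≟ d)) (does (iter φ 2 d ≟ d))
    (λ h → ≤-reflexive (trans (sumF-cong {12} (none h)) (sumF-0 12)))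
    (λ h → window≤ 6 2 refl d λ { 1 _ _ → φ-moves h ; (suc (suc _)) _ (s≤s (s≤s ())) })
    (λ h ne → window≤ 4 3 refl d λ { 1 _ _ → φ-moves h ; 2 _ _ → false⇒¬ {2} ne ; (suc (suc (suc _))) _
          (s≤s (s≤s (s≤s ()))) })
    (λ h ne ne′ → window≤ 3 4 refl d λ { 1 _ _ → φ-moves h ; 2 _ _ → false⇒¬ {2} ne ; 3 _ _ → false⇒¬ {3} ne′
                                   ; (suc (suc (suc (suc _)))) _ (s≤s (s≤s (s≤s (s≤s ())))) })
    where
    cases : ∀ {W} a three two → (a ≡ false → W ≤ 0) → (a ≡ true → W ≤ 6) → (a ≡ true → two ≡ false → W ≤ 4) →
            (a ≡ true → two ≡ false → three ≡ false → W ≤ 3) → W ≤ 3 * ⟦ a ⟧ + (⟦ a ∧ three ⟧ + 3 * ⟦ a ∧ two ⟧)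
    cases false _     _     h₀ _  _  _  = h₀ refl
    cases true  three true  _  h₂ _  _  = ≤-trans (h₂ refl) (+-monoʳ-≤ 3 (m≤n+m 3 ⟦ three ⟧))
    cases true  true  false _  _  h₃ _  = h₃ refl refl
    cases true  false false _  _  _  h₄ = h₄ refl refl refl
    false⇒¬ : ∀ {k} → does (iter φ k d ≟ d) ≡ false → ¬ iter φ k d ≡ d
    false⇒¬ {k} ne eq = case trans (≡.sym ne) (dec-true (iter φ k d ≟ d) eq) of λ ()
    none : Adj G d ≡ false → ∀ (k : Fin 12) → ⟦ q (iter φ (toℕ k) d) ⟧ ≡ 0
    none h k = cong ⟦_⟧ (≢true⇒≡false λ qk → case trans (≡.sym (proj₁ (∧-true qk)))
          (trans (Adj-iter (toℕ k) d) h) of λ ())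

  ∑window : ∀ N → N * faces G rot ≤ ∑ (window N)
  ∑window N = begin
    N * faces G rot ≡⟨ cong (N *_) #q ⟨
    N * # q ≡⟨ sumF-const N (# q) ⟨
    sumF {N} (λ _ → # q) ≤⟨ sumF-mono {N} (λ k → #≤#∘ (iter-injective φ φ-injective (toℕ k)) q) ⟩
    sumF {N} (λ k → # (λ d → q (iter φ (toℕ k) d))) ≡⟨ sumF-swap {N} (λ k i → ⟦ q (iter φ (toℕ k) (enum i)) ⟧) ⟩
    ∑ (window N) ∎
    where open ≤-Reasoning

  -- Twelve is the least common multiple of 2, 3 and 4. Each of the `2 * edges G` darts contributes
  -- 3, the share for length four; a dart on a face of length three adds 1 more, on a face of length
  -- two 3 more.
  12faces≤ : 12 * faces G rot ≤ 6 * edges G + (# (fixed 3) + 3 * # (fixed 2))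
  12faces≤ = begin
    12 * faces G rot ≤⟨ ∑window 12 ⟩
    ∑ (window 12) ≤⟨ sumF-mono (λ i → twelve (enum i)) ⟩
    ∑ (λ d → 3 * ⟦ Adj G d ⟧ + (⟦ fixed 3 d ⟧ + 3 * ⟦ fixed 2 d ⟧))
      ≡⟨ sumF-+ (λ i → 3 * ⟦ Adj G (enum i) ⟧) _ ⟩
    ∑ (λ d → 3 * ⟦ Adj G d ⟧) + ∑ (λ d → ⟦ fixed 3 d ⟧ + 3 * ⟦ fixed 2 d ⟧)
      ≡⟨ cong₂ _+_ (trans (sumF-*ˡ 3 (λ i → ⟦ Adj G (enum i) ⟧))
            (trans (cong (3 *_) (#Adj G)) (≡.sym (*-assoc 3 2 (edges G)))))
           (trans (sumF-+ (λ i → ⟦ fixed 3 (enum i) ⟧) _) (cong (# (fixed 3) +_)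
                 (sumF-*ˡ 3 (λ i → ⟦ fixed 2 (enum i) ⟧)))) ⟩
    6 * edges G + (# (fixed 3) + 3 * # (fixed 2)) ∎
    where open ≤-Reasoning

  -- A face of length three through `(u , v)` turns at `v` from `u` to `rot v u` and returns from
  -- there to `u`, so these two are adjacent and give a corner at `v`.
  #fixed₃≤ : # (fixed 3) ≤ sumF corners
  #fixed₃≤ = begin
    # (fixed 3) ≡⟨ ∑-darts (⟦_⟧ ∘ fixed 3) ⟩
    sumF (λ u → sumF (λ v → ⟦ fixed 3 (u , v) ⟧)) ≤⟨ sumF-mono (λ u → sumF-mono (λ v → ⟦⟧-mono (triangle u v))) ⟩
    sumF (λ u → sumF (λ v → ⟦ adj G v u ∧ adj G u (rot v u) ⟧))
          ≡⟨ sumF-swap (λ u v → ⟦ adj G v u ∧ adj G u (rot v u) ⟧) ⟩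
    sumF corners ∎
    where
    open ≤-Reasoning
    triangle : ∀ u v → fixed 3 (u , v) ≡ true → adj G v u ∧ adj G u (rot v u) ≡ true
    triangle u v h = true∧ hvu (trans (sym G u w) (subst (λ z → adj G w z ≡ true) (cong proj₁ back) hwx))
      where
      huv = proj₁ (∧-true h)
      hvu : adj G v u ≡ true
      hvu = adj-swap G huv
      w = rot v u
      hvw : adj G v w ≡ true
      hvw = closed v u hvu
      x = rot w v
      hwx : adj G w x ≡ true
      hwx = closed w v (adj-swap G hvw)
      back : (x , rot x w) ≡ (u , v)
      back = trans (≡.sym (trans (cong (φ ∘ φ) (φ-adj (u , v) huv))
            (trans (cong φ (φ-adj (v , w) hvw)) (φ-adj (w , x) hwx))))
                   (does⇒ (iter φ 3 (u , v) ≟ (u , v)) (proj₂ (∧-true {a = adj G u v} h)))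

  only-neighbour : ∀ {u v w} → adj G u v ≡ true → rot u v ≡ v → adj G u w ≡ true → v ≡ w
  only-neighbour {u} {v} {w} hv fix hw with cyclic u v w hv hw
  ... | k , eq = trans (≡.sym (stays k)) eq
    where
    stays : ∀ k → iter (rot u) k v ≡ v
    stays zero    = refl
    stays (suc k) = trans (cong (rot u) (stays k)) fix

  isolatedEdge : Fin n → Fin n → Bool
  isolatedEdge u v = adj G u v ∧ (does (rot u v Fin.≟ v) ∧ does (rot v u Fin.≟ u))

  isolatedEdge-elim : ∀ {u v} → isolatedEdge u v ≡ true → adj G u v ≡ true × rot u v ≡ v × rot v u ≡ u
  isolatedEdge-elim {u} {v} h =
    let a , b = ∧-true h ; c , d = ∧-true b in a , does⇒ (rot u v Fin.≟ v) c , does⇒ (rot v u Fin.≟ u) d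

  isolatedEdge-swap : ∀ {u v} → isolatedEdge u v ≡ true → isolatedEdge v u ≡ true
  isolatedEdge-swap {u} {v} h = let a , b , c = isolatedEdge-elim h in
    true∧ (adj-swap G a) (true∧ (dec-true (rot v u Fin.≟ u) c) (dec-true (rot u v Fin.≟ v) b))

  fixed₂⇒isolatedEdge : ∀ u v → fixed 2 (u , v) ≡ true → isolatedEdge u v ≡ true
  fixed₂⇒isolatedEdge u v h = true∧ huv (true∧
    (dec-true (rot u v Fin.≟ v) (trans (cong (λ z → rot z v) (≡.sym w≡u)) (cong proj₂ back)))
    (dec-true (rot v u Fin.≟ u) w≡u))
    where
    huv = proj₁ (∧-true h)
    back : (rot v u , rot (rot v u) v) ≡ (u , v)
    back = trans (≡.sym (trans (cong φ (φ-adj (u , v) huv)) (φ-adj (v , rot v u) (closed v u (adj-swap G huv)))))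
                 (does⇒ (iter φ 2 (u , v) ≟ (u , v)) (proj₂ (∧-true {a = adj G u v} h)))
    w≡u : rot v u ≡ u
    w≡u = cong proj₁ back

  -- A face of length two surrounds an isolated edge, which is a component of its own. Its smaller
  -- end is the `compRep`, and the factor counts the two darts.
  #fixed₂≤ : # (fixed 2) ≤ 2 * #nontrivComps G
  #fixed₂≤ = begin
    # (fixed 2) ≡⟨ ∑-darts (⟦_⟧ ∘ fixed 2) ⟩
    sumF (λ u → sumF (λ v → ⟦ fixed 2 (u , v) ⟧)) ≤⟨ sumF-mono (λ u → sumF-mono (split u)) ⟩
    sumF (λ u → sumF (λ v → i u v + i v u)) ≡⟨ trans (sumF-cong (λ u → sumF-+ (i u) (λ v → i v u)))
          (sumF-+ (λ u → sumF (i u)) (λ u → sumF (λ v → i v u))) ⟩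
    sumF (λ u → sumF (i u)) + sumF (λ u → sumF (λ v → i v u)) ≡⟨ cong (sumF (λ u → sumF (i u)) +_) (sumF-swap i) ⟨
    sumF (λ u → sumF (i u)) + sumF (λ u → sumF (i u)) ≤⟨ +-mono-≤ perComponent perComponent ⟩
    #nontrivComps G + #nontrivComps G ≡⟨ cong (#nontrivComps G +_) (+-identityʳ _) ⟨
    2 * #nontrivComps G ∎
    where
    open ≤-Reasoning
    lower : Fin n → Fin n → Bool
    lower u v = isolatedEdge u v ∧ (toℕ u <ᵇ toℕ v)
    i : Fin n → Fin n → ℕ
    i u v = ⟦ lower u v ⟧
    split : ∀ u v → ⟦ fixed 2 (u , v) ⟧ ≤ i u v + i v u
    split u v with fixed 2 (u , v) in h
    ... | false = z≤n
    ... | true with <-cmp (toℕ u) (toℕ v)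
    ...   | tri< lt _ _ = ≤-trans (≤-reflexive (cong ⟦_⟧ (≡.sym
          (true∧ (fixed₂⇒isolatedEdge u v h) (<ᵇ-true lt))))) (m≤m+n (i u v) (i v u))
    ...   | tri≈ _ eq _ = contradiction (Fin.toℕ-injective eq) (adj-≢ G (proj₁ (∧-true h)))
    ...   | tri> _ _ gt = ≤-trans (≤-reflexive (cong ⟦_⟧ (≡.sym
          (true∧ (isolatedEdge-swap (fixed₂⇒isolatedEdge u v h)) (<ᵇ-true gt))))) (m≤n+m (i v u) (i u v))
    perComponent : sumF (λ u → sumF (i u)) ≤ #nontrivComps G
    perComponent = ≤-trans (sumF-mono pointwise) (≤-reflexive
          (≡.sym (count≡sumF (λ u → compRep G u ∧ not (isolated G u)))))
      where
      pointwise : ∀ u → sumF (i u) ≤ ⟦ compRep G u ∧ not (isolated G u) ⟧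
      pointwise u with compRep G u ∧ not (isolated G u) in eq
      ... | true = sumF-≤1 (lower u) λ v w hv hw →
              let a , b , _ = isolatedEdge-elim (proj₁ (∧-true hv)) in only-neighbour a b (proj₁ (isolatedEdge-elim (proj₁ (∧-true hw))))
      ... | false = ≤-reflexive (trans (sumF-cong none) (sumF-0 n))
        where
        none : ∀ v → i u v ≡ 0
        none v = cong ⟦_⟧ (≢true⇒≡false λ h →
          let h′ , lt = ∧-true h
              huv , fix , fix′ = isolatedEdge-elim h′
          in case trans (≡.sym eq) (true∧ (isRep huv fix fix′ (<ᵇ-true⁻ lt))
               (trans (¬isolated G u) (neighbour-adj G huv))) of λ ())
          where
          isRep : adj G u v ≡ true → rot u v ≡ v → rot v u ≡ u → toℕ u < toℕ v → compRep G u ≡ true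
          isRep huv fix fix′ lt = compRep-intro G {X = λ w → w ≡ u ⊎ w ≡ v}
            (λ { (inj₁ refl) h → inj₂ (≡.sym (only-neighbour huv fix h))
               ; (inj₂ refl) h → inj₁ (≡.sym (only-neighbour (adj-swap G huv) fix′ h)) })
            (inj₁ refl) (λ { _ (inj₁ refl) → ≤-refl ; _ (inj₂ refl) → <⇒≤ lt })

  some-component : 1 ≤ edges G → 1 ≤ #nontrivComps G
  some-component 1≤E with 1≤sumF⇒∃ _ 1≤E
  ... | u , hu with 1≤sumF⇒∃ (λ v → ⟦ adj G u v ∧ (toℕ u <ᵇ toℕ v) ⟧)
                     (≤-trans hu (≤-reflexive (count≡sumF (λ v → adj G u v ∧ (toℕ u <ᵇ toℕ v)))))
  ...   | v , hv = ≤-trans (∃⇒1≤sumF _ r (≤-reflexive (≡.sym (cong ⟦_⟧ chosen))))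
                     (≤-reflexive (≡.sym (count≡sumF (λ u → compRep G u ∧ not (isolated G u)))))
    where
    huv : adj G u v ≡ true
    huv = proj₁ (∧-true (⟦⟧-true hv))
    least-vertex = least (λ w → adj G w (neighbour G w)) (neighbour-adj G huv)
    r = proj₁ least-vertex
    hr = proj₁ (proj₂ least-vertex)
    chosen : compRep G r ∧ not (isolated G r) ≡ true
    chosen = true∧ (compRep-intro G {X = λ w → adj G w (neighbour G w) ≡ true}
        (λ _ h → neighbour-adj G (adj-swap G h)) hr (proj₂ (proj₂ least-vertex)))
      (trans (¬isolated G r) hr)

  module _ (euler : n + faces G rot ≡ edges G + 2 * #nontrivComps G + #isolated G) where

    -- Twelve times the Euler equation contains `24 * C`. The isolated edges consume `6 * C` of it;
    -- the remaining `18 * C` is positive as soon as there is an edge, which makes the inequality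
    -- strict.
    6edges≤ : 1 ≤ edges G → 6 * edges G < 12 * n + sumF corners
    6edges≤ 1≤E = +-cancelʳ-< (6 * E + 6 * C) (6 * E) (12 * n + sumF corners) (begin-strict
      6 * E + (6 * E + 6 * C)                          <⟨ m<m+n _ {18 * C + 12 * I}
            (≤-trans (some-component 1≤E) (≤-trans (m≤m+n C (17 * C)) (m≤m+n (18 * C) (12 * I)))) ⟩
      6 * E + (6 * E + 6 * C) + (18 * C + 12 * I)      ≡⟨ arith₁ E C I ⟩
      12 * (E + 2 * C + I)                             ≡⟨ cong (12 *_) euler ⟨
      12 * (n + faces G rot)                           ≡⟨ *-distribˡ-+ 12 n (faces G rot) ⟩
      12 * n + 12 * faces G rot                        ≤⟨ +-monoʳ-≤ (12 * n) 12faces≤ ⟩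
      12 * n + (6 * E + (# (fixed 3) + 3 * # (fixed 2))) ≤⟨ +-monoʳ-≤ (12 * n)
            (+-monoʳ-≤ (6 * E) (+-mono-≤ #fixed₃≤ (*-monoʳ-≤ 3 #fixed₂≤))) ⟩
      12 * n + (6 * E + (sumF corners + 3 * (2 * C)))  ≡⟨ arith₂ n E (sumF corners) C ⟩
      12 * n + sumF corners + (6 * E + 6 * C)          ∎)
      where
      open ≤-Reasoning
      E = edges G
      C = #nontrivComps G
      I = #isolated G
      arith₁ : ∀ E C I → 6 * E + (6 * E + 6 * C) + (18 * C + 12 * I) ≡ 12 * (E + 2 * C + I)
      arith₁ = solve-∀
      arith₂ : ∀ n E K C → 12 * n + (6 * E + (K + 3 * (2 * C))) ≡ 12 * n + K + (6 * E + 6 * C)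
      arith₂ = solve-∀

-- From the average degree to edge counts; the three cases

open import Data.Integer using (+_)
import Data.Integer as ℤ using (_≤_)
import Data.Integer.Properties as ℤ
open import Data.Rational using (_/_) renaming (_≤_ to _≤ℚ_)
import Data.Rational.Properties as ℚ
open ℚ using (toℚᵘ-fromℚᵘ; toℚᵘ-mono-≤)
open import Data.Rational.Unnormalised using (mkℚᵘ; *≤*)
import Data.Rational.Unnormalised.Properties as ℚᵘ

-- The fraction in `avgDeg` is stored in lowest terms. Passing to unnormalised rationals restores
-- the denominator `suc n`, and there the order is cross-multiplication.
≤avgDeg : ∀ {n} (G : Graph (suc n)) k → (+ k / 1) ≤ℚ avgDeg G → k * suc n ≤ 2 * edges G
≤avgDeg {n} G k h with ℚᵘ.≤-trans (ℚᵘ.≤-reflexive (ℚᵘ.≃-sym (toℚᵘ-fromℚᵘ (mkℚᵘ (+ k) 0))))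
                        (ℚᵘ.≤-trans (toℚᵘ-mono-≤ h) (ℚᵘ.≤-reflexive (toℚᵘ-fromℚᵘ (mkℚᵘ (+ (2 * edges G)) n))))
... | *≤* h′ = ≤-trans (ℤ.drop‿+≤+ (subst₂ ℤ._≤_ (≡.sym (ℤ.pos-* k (suc n))) (≡.sym (ℤ.pos-* (2 * edges G) 1)) h′))
                       (≤-reflexive (*-identityʳ (2 * edges G)))

avgDeg≤ : ∀ {n} (G : Graph (suc n)) k → avgDeg G ≤ℚ (+ k / 1) → 2 * edges G ≤ k * suc n
avgDeg≤ {n} G k h with ℚᵘ.≤-trans (ℚᵘ.≤-reflexive (ℚᵘ.≃-sym (toℚᵘ-fromℚᵘ (mkℚᵘ (+ (2 * edges G)) n))))
                        (ℚᵘ.≤-trans (toℚᵘ-mono-≤ h) (ℚᵘ.≤-reflexive (toℚᵘ-fromℚᵘ (mkℚᵘ (+ k) 0))))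
... | *≤* h′ = ≤-trans (≤-reflexive (≡.sym (*-identityʳ (2 * edges G))))
                 (ℤ.drop‿+≤+ (subst₂ ℤ._≤_ (≡.sym (ℤ.pos-* (2 * edges G) 1)) (≡.sym (ℤ.pos-* k (suc n))) h′))

theorem2p1 : (n : ℕ) (G : Graph (suc n)) → Planar G →
    ¬ ( ((+ 4 / 1) ≤ℚ avgDeg G × (∀ v → e G v ≡ 0))
    ⊎ (avgDeg G ≡ (+ 5 / 1) × Σ ℕ (λ c → 1 ≤ c × c ≤ 3 × (∀ v → e G v ≡ c)))
    ⊎ (avgDeg G ≤ℚ (+ 5 / 1) × (∀ v → e G v ≡ 6)) )
theorem2p1 n G (rot , isRot , euler) (inj₁ (4≤d , e≡0)) =
  <⇒≱ (6edges≤ euler 1≤E) (begin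
    12 * suc n + sumF corners ≡⟨ cong (λ k → 12 * suc n + k) (trans (sumF-cong {suc n} no-corners) (sumF-0 (suc n))) ⟩
    12 * suc n + 0            ≡⟨ arith (suc n) ⟩
    3 * (4 * suc n)           ≤⟨ *-monoʳ-≤ 3 bound ⟩
    3 * (2 * edges G)         ≡⟨ *-assoc 3 2 (edges G) ⟨
    6 * edges G               ∎)
  where
  open ≤-Reasoning
  open Corners G rot isRot
  open FaceCount G rot isRot
  bound = ≤avgDeg G 4 4≤d
  1≤E : 1 ≤ edges G
  1≤E = *-cancelˡ-< 2 0 (edges G) (≤-trans (s≤s z≤n) bound)
  no-corners : ∀ v → corners v ≡ 0
  no-corners v = n≤0⇒n≡0 (subst (λ k → corners v ≤ 2 * k) (e≡0 v) (corners≤2e v))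
  arith : ∀ n → 12 * n + 0 ≡ 3 * (4 * n)
  arith = solve-∀
theorem2p1 n G (rot , isRot , euler) (inj₂ (inj₁ (d≡5 , c , _ , c≤3 , e≡c))) =
  <⇒≱ (6edges≤ euler 1≤E) (begin
    -- The bound 3 serves all three values of `c`, and 12 + 3 = 3 * 5 meets the average degree
    -- exactly.
    12 * suc n + sumF corners ≤⟨ +-monoʳ-≤ (12 * suc n) (sumF-mono {suc n}
          (λ v → corners≤max v 3 (s≤s (s≤s z≤n)) (≤-trans (≤-reflexive (e≡c v)) c≤3))) ⟩
    12 * suc n + sumF {suc n} (λ _ → 3) ≡⟨ cong (λ k → 12 * suc n + k) (sumF-const (suc n) 3) ⟩
    12 * suc n + suc n * 3    ≡⟨ arith (suc n) ⟩
    3 * (5 * suc n)           ≤⟨ *-monoʳ-≤ 3 bound ⟩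
    3 * (2 * edges G)         ≡⟨ *-assoc 3 2 (edges G) ⟨
    6 * edges G               ∎)
  where
  open ≤-Reasoning
  open Corners G rot isRot
  open FaceCount G rot isRot
  bound = ≤avgDeg G 5 (ℚ.≤-reflexive (≡.sym d≡5))
  1≤E : 1 ≤ edges G
  1≤E = *-cancelˡ-< 2 0 (edges G) (≤-trans (s≤s z≤n) bound)
  arith : ∀ n → 12 * n + n * 3 ≡ 3 * (5 * n)
  arith = solve-∀
theorem2p1 n G (rot , isRot , euler) (inj₂ (inj₂ (d≤5 , e≡6))) =
  <⇒≱ (begin-strict
    5 * suc n                                             ≡⟨ *-comm 5 (suc n) ⟩
    suc n * 5                                             <⟨ n<1+n _ ⟩
    suc (suc n * 5)                                       ≡⟨ cong₂ _+_ (sumF-δ v (λ _ → 1)) (sumF-const (suc n) 5) ⟨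
    sumF (λ u → if does (v Fin.≟ u) then 1 else 0) + sumF {suc n} (λ _ → 5)
          ≡⟨ sumF-+ (λ u → if does (v Fin.≟ u) then 1 else 0) (λ _ → 5) ⟨
    sumF (λ u → (if does (v Fin.≟ u) then 1 else 0) + 5)  ≤⟨ sumF-mono pointwise ⟩
    sumF (degree G)                                       ≡⟨ ∑degree G ⟩
    2 * edges G                                           ∎)
    (avgDeg≤ G 5 d≤5)
  where
  open ≤-Reasoning
  open Corners G rot isRot
  special = CliqueBoundary.consecutive-vertex G rot isRot euler fz
  v = proj₁ special
  -- Degree at least five everywhere gives only average degree at least 5; the special vertex `v`,
  -- of degree at least six, supplies the excess.
  pointwise : ∀ u → (if does (v Fin.≟ u) then 1 else 0) + 5 ≤ degree G u
  pointwise u with v Fin.≟ u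
  ... | yes refl = ≤-trans (≤-reflexive (≡.sym (e≡6 v))) (e≤degree v (proj₂ special))
  ... | no _     = 5≤degree euler (e≡6 u)
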